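{- Let $p$ be a prime, $k\ge0$ and $m\ge1$ integers, and let $\mathcal S_1,\dots,\mathcal S_m$ be $\mathbb Z_p$-combinatorial spheres (not necessarily of the same dimension) with pairwise disjoint vertex sets. Let $x$ be a new vertex. Then there does not exist a simplicial map \[f:\ x*\operatorname{Bd}^k(\mathcal S_1*\cdots*\mathcal S_m)\to \mathcal S_1*\cdots*\mathcal S_m\] whose restriction $f|_{\operatorname{Bd}^k(\mathcal S_1*\cdots*\mathcal S_m)}:\operatorname{Bd}^k(\mathcal S_1*\cdots*\mathcal S_m)\to\mathcal S_1*\cdots*\mathcal S_m$ is $\mathbb Z_p$-equivariant.
   Context: A simplicial complex is a finite nonempty collection of finite sets closed under subsets (so it contains $\emptyset$); $\dim\sigma=|\sigma|-1$; $\alpha$ is a facet of $\beta$ if $\alpha\subseteq\beta$ and $\dim\alpha=\dim\beta-1$. A discrete vector field $\mathcal V$ on $\mathcal K$ is a set of pairs $(\alpha,\beta)$ of simplices ($\alpha=\emptyset$ allowed) with $\alpha$ a facet of $\beta$, each simplex in at most one pair. A $\mathcal V$-trajectory is a sequence $\beta_0,\alpha_1,\beta_1,\dots,\alpha_r,\beta_r$ of alternately $q$- and $(q-1)$-simplices with $(\alpha_i,\beta_i)\in\mathcal V$, $\alpha_i\subsetneq\beta_{i-1}$, $\beta_{i-1}\ne\beta_i$; it is nontrivial closed if $r>0$ and $\beta_r=\beta_0$. A gradient vector field has no nontrivial closed trajectory. A nonempty simplex is critical if it lies in no pair, or is a $0$-simplex $\sigma$ with $(\emptyset,\sigma)\in\mathcal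 V$. A $d$-dimensional pseudomanifold is a simplicial complex whose maximal simplices all have dimension $d$, with every $(d-1)$-simplex in exactly two $d$-simplices, and any two $d$-simplices joined by a chain of $d$-simplices in which consecutive ones meet in a $(d-1)$-simplex. A combinatorial $d$-sphere is a $d$-dimensional pseudomanifold admitting a gradient vector field with exactly two critical simplices, one of dimension $d$ and one of dimension $0$. The join of complexes with disjoint vertex sets is $\mathcal K_1*\mathcal K_2=\{\sigma\sqcup\tau:\sigma\in\mathcal K_1,\tau\in\mathcal K_2\}$; the cone $x*\mathcal K$ is $\{\emptyset,\{x\}\}*\mathcal K$ for $x\notin V(\mathcal K)$. $\operatorname{Bd}(\mathcal K)$ has vertices $v_\sigma$ for nonempty $\sigma\in\mathcal K$ and simplices $\{v_{\sigma_0},\dots,v_{\sigma_n}\}$ for chains $\sigma_0\subsetneq\dots\subsetneq\sigma_n$ (and $\emptyset$); $\operatorname{Bd}^k$ is its $k$-fold iterate ($\operatorname{Bd}^0=\mathrm{id}$). A simplicial map is a vertex map sending simplices to simplices. A simplicial $\mathbb Z_p$-action on a complex is an action by simplicial automorphisms; it is free if no non-identity element maps a nonempty simplex to itself. A $\mathbb Z_p$-combinatorial sphere is a combinatorial sphere with a free simplicial $\mathbb Z_p$-action. $\mathbb Z_p$ acts on a join diagonally, $g\cdot(\sigma\sqcup\tau)=g\cdot\sigma\sqcup g\cdot\tau$, and on $\operatorname{Bd}^k$ by $g\cdot v_\sigma=v_{g\cdot\sigma}$. A simplicial map $f$ is $\mathbb Z_p$-equivariant if $f(g\cdot\sigma)=g\cdot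 f(\sigma)$ for all $g,\sigma$. -}

module Defs where

open import Data.Nat using (ℕ; zero; suc; _+_; _^_; _≤_; _<_)
open import Data.Fin using (Fin; zero; suc; _↑ˡ_; _↑ʳ_; splitAt; inject₁; fromℕ)
open import Data.Fin.Subset using (Subset; _∈_; _⊆_; _⊂_; ∣_∣; Nonempty; ⁅_⁆; _∪_; _∩_)
  renaming (⊥ to ∅)
open import Data.Vec using (Vec; []; _∷_; take; drop)
open import Data.Bool using (true; false)
open import Data.Sum using (_⊎_; inj₁; inj₂)
open import Data.Product using (Σ; ∃; _×_; _,_)
open import Data.Unit using (⊤)
open import Data.Empty using (⊥)
open import Function using (_∘_; id)
open import Relation.Nullary using (¬_)
open import Relation.Binary.PropositionalEquality using (_≡_; _≢_)
open import Relation.Binary.Construct.Closure.ReflexiveTransitive using (Star)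

-- Finite sets of vertices.  A complex has vertex type Fin n; a simplex
-- is a subset of Fin n (Data.Fin.Subset = Vec Bool n, so equality of
-- simplices is propositional equality).  Vertices of Fin n lying in no
-- simplex are "ghost" vertices and play no role.

img : ∀ {n m} → (Fin n → Fin m) → Subset n → Subset m
img {m = m} f []            = ∅
img f (true  ∷ s) = ⁅ f zero ⁆ ∪ img (f ∘ suc) s
img f (false ∷ s) = img (f ∘ suc) s

record Complex : Set₁ where
  field
    n         : ℕ
    IsSimplex : Subset n → Set
open Complex public

IsSimplicialComplex : Complex → Set
IsSimplicialComplex K =
  IsSimplex K ∅ × (∀ {σ τ} → τ ⊆ σ → IsSimplex K σ → IsSimplex K τ)

-- |σ| = dim σ + 1.  α is a facet of β.
IsFacet : ∀ {n} → Subset n → Subset n → Set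
IsFacet α β = α ⊆ β × suc ∣ α ∣ ≡ ∣ β ∣

record DiscreteVectorField (K : Complex) : Set₁ where
  field
    Pair     : Subset (n K) → Subset (n K) → Set
    pair-ok  : ∀ {α β} → Pair α β → IsSimplex K β × IsSimplex K α × IsFacet α β
    at-most-one : ∀ {α β α' β'} → Pair α β → Pair α' β' →
      (α ≡ α' ⊎ α ≡ β' ⊎ β ≡ α' ⊎ β ≡ β') → α ≡ α' × β ≡ β'
open DiscreteVectorField public

-- a V-trajectory β₀ α₁ β₁ … α_r β_r, given by β : Fin (suc r) → _ and
-- α : Fin r → _ (α i is α_{i+1}); β's are q-simplices, α's (q-1)-simplices
IsTrajectory : ∀ {K} → DiscreteVectorField K → (r : ℕ) →
  (Fin (suc r) → Subset (n K)) → (Fin r → Subset (n K)) → Set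
IsTrajectory {K} V r β α =
  Σ ℕ (λ q →
    (∀ j → ∣ β j ∣ ≡ suc q) × (∀ i → ∣ α i ∣ ≡ q) ×
    (∀ i → Pair V (α i) (β (suc i)) × α i ⊂ β (inject₁ i) × β (inject₁ i) ≢ β (suc i)))

IsGradient : ∀ {K} → DiscreteVectorField K → Set
IsGradient {K} V = ∀ r β α → IsTrajectory V (suc r) β α → β (fromℕ (suc r)) ≢ β zero

IsCritical : ∀ {K} → DiscreteVectorField K → Subset (n K) → Set
IsCritical {K} V σ = IsSimplex K σ × Nonempty σ ×
  ((∀ α β → Pair V α β → α ≢ σ × β ≢ σ) ⊎ (∣ σ ∣ ≡ 1 × Pair V ∅ σ))

AdjacentFacets : (K : Complex) (d : ℕ) → Subset (n K) → Subset (n K) → Set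
AdjacentFacets K d τ τ' =
  IsSimplex K τ × ∣ τ ∣ ≡ suc d × IsSimplex K τ' × ∣ τ' ∣ ≡ suc d ×
  ∣ τ ∩ τ' ∣ ≡ d

IsPseudomanifold : Complex → ℕ → Set
IsPseudomanifold K d =
  IsSimplicialComplex K ×
  (∀ σ → IsSimplex K σ → ∣ σ ∣ ≤ suc d) ×
  (∀ σ → IsSimplex K σ → ∃ λ τ → IsSimplex K τ × σ ⊆ τ × ∣ τ ∣ ≡ suc d) ×
  (∀ σ → IsSimplex K σ → ∣ σ ∣ ≡ d →
     ∃ λ τ₁ → ∃ λ τ₂ → τ₁ ≢ τ₂ ×
       IsSimplex K τ₁ × σ ⊆ τ₁ × ∣ τ₁ ∣ ≡ suc d ×
       IsSimplex K τ₂ × σ ⊆ τ₂ × ∣ τ₂ ∣ ≡ suc d ×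
       (∀ τ → IsSimplex K τ → σ ⊆ τ → ∣ τ ∣ ≡ suc d → τ ≡ τ₁ ⊎ τ ≡ τ₂)) ×
  (∀ τ τ' → IsSimplex K τ → ∣ τ ∣ ≡ suc d → IsSimplex K τ' → ∣ τ' ∣ ≡ suc d →
     Star (AdjacentFacets K d) τ τ')

IsCombinatorialSphere : Complex → ℕ → Set₁
IsCombinatorialSphere K d =
  IsPseudomanifold K d ×
  Σ (DiscreteVectorField K) λ V → IsGradient V ×
    ∃ λ c₁ → ∃ λ c₀ → c₁ ≢ c₀ ×
      IsCritical V c₁ × ∣ c₁ ∣ ≡ suc d × IsCritical V c₀ × ∣ c₀ ∣ ≡ 1 ×
      (∀ σ → IsCritical V σ → σ ≡ c₁ ⊎ σ ≡ c₀)

-- Z_p-actions.  An action of Z_p on Fin n is given by act : ℕ → (Fin n →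
-- Fin n) with act 0 = id, act (a+b) = act a ∘ act b, act p = id
-- (i.e. a homomorphism ℕ → End factoring through Z_p = ℕ/pℕ);
-- group elements are g < p.

IsZpAction : (p : ℕ) (K : Complex) → (ℕ → Fin (n K) → Fin (n K)) → Set
IsZpAction p K act =
  (∀ v → act 0 v ≡ v) × (∀ a b v → act (a + b) v ≡ act a (act b v)) ×
  (∀ v → act p v ≡ v) ×
  -- by simplicial automorphisms (inverse of act g is act (p - g))
  (∀ g σ → IsSimplex K σ → IsSimplex K (img (act g) σ))

IsFree : (p : ℕ) (K : Complex) → (ℕ → Fin (n K) → Fin (n K)) → Set
IsFree p K act = ∀ g → 0 < g → g < p → ∀ σ → IsSimplex K σ → Nonempty σ →
  img (act g) σ ≢ σ

record ZpSphere (p : ℕ) : Set₁ where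
  field
    cx     : Complex
    dim    : ℕ
    sphere : IsCombinatorialSphere cx dim
    act    : ℕ → Fin (n cx) → Fin (n cx)
    action : IsZpAction p cx act
    free   : IsFree p cx act
open ZpSphere public

record CxAct : Set₁ where
  field
    K   : Complex
    act : ℕ → Fin (n K) → Fin (n K)
open CxAct public

toCxAct : ∀ {p} → ZpSphere p → CxAct
toCxAct S = record { K = cx S ; act = act S }

joinCx : Complex → Complex → Complex
joinCx K₁ K₂ = record
  { n = n K₁ + n K₂
  ; IsSimplex = λ σ → IsSimplex K₁ (take (n K₁) σ) × IsSimplex K₂ (drop (n K₁) σ) }

joinMap : ∀ {n₁ n₂} → (Fin n₁ → Fin n₁) → (Fin n₂ → Fin n₂) →
  Fin (n₁ + n₂) → Fin (n₁ + n₂)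
joinMap {n₁} {n₂} f g i with splitAt n₁ i
... | inj₁ j = f j ↑ˡ n₂
... | inj₂ j = n₁ ↑ʳ g j

joinCA : CxAct → CxAct → CxAct
joinCA A B = record
  { K = joinCx (K A) (K B) ; act = λ g → joinMap (act A g) (act B g) }

-- S₁ * S₂ * ⋯ * S_m  (for m = 0 this is {∅}; the theorem assumes m ≥ 1)
joinAll : ∀ {p} (m : ℕ) → (Fin m → ZpSphere p) → CxAct
joinAll zero          S = record { K = record { n = 0 ; IsSimplex = λ _ → ⊤ } ; act = λ _ → id }
joinAll (suc zero)    S = toCxAct (S zero)
joinAll (suc (suc m)) S = joinCA (toCxAct (S zero)) (joinAll (suc m) (S ∘ suc))

toSub : ∀ n → Fin (2 ^ n) → Subset n
toSub zero    _ = []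
toSub (suc n) i with splitAt (2 ^ n) i
... | inj₁ j = false ∷ toSub n j
... | inj₂ j with splitAt (2 ^ n) {0} j
...   | inj₁ j' = true ∷ toSub n j'
...   | inj₂ ()

fromSub : ∀ {n} → Subset n → Fin (2 ^ n)
fromSub []                  = zero
fromSub {suc n} (false ∷ s) = fromSub s ↑ˡ (2 ^ n + 0)
fromSub {suc n} (true  ∷ s) = 2 ^ n ↑ʳ (fromSub s ↑ˡ 0)

-- barycentric subdivision: vertex i ∈ Fin (2 ^ n) stands for the subset
-- toSub n i; a simplex is a set of vertices standing for a chain of
-- nonempty simplices of K (vertices standing for non-simplices are ghosts)
Bd : Complex → Complex
Bd K = record
  { n = 2 ^ n K
  ; IsSimplex = λ S → ∀ i → i ∈ S →
      (Nonempty (toSub (n K) i) × IsSimplex K (toSub (n K) i)) ×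
      (∀ j → j ∈ S → toSub (n K) i ⊆ toSub (n K) j ⊎ toSub (n K) j ⊆ toSub (n K) i) }

BdCA : CxAct → CxAct
BdCA A = record
  { K = Bd (K A)
  ; act = λ g i → fromSub (img (act A g) (toSub (n (K A)) i)) }

BdIter : ℕ → CxAct → CxAct
BdIter zero    A = A
BdIter (suc k) A = BdCA (BdIter k A)

pointCx : Complex
pointCx = record { n = 1 ; IsSimplex = λ _ → ⊤ }

Cone : Complex → Complex
Cone L = joinCx pointCx L

coneIncl : ∀ {N} → Fin N → Fin (1 + N)
coneIncl i = 1 ↑ʳ i

IsSimplicialMap : (K L : Complex) → (Fin (n K) → Fin (n L)) → Set
IsSimplicialMap K L f = ∀ σ → IsSimplex K σ → IsSimplex L (img f σ)

IsEquivariant : (p : ℕ) (A B : CxAct) → (Fin (n (K A)) → Fin (n (K B))) → Set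
IsEquivariant p A B f = ∀ g → g < p → ∀ σ → IsSimplex (K A) σ →
  img f (img (act A g) σ) ≡ img (act B g) (img f σ)

{-# OPTIONS --safe #-}
module Submission where

-- An equivariant Lefschetz argument.  Let T be the join, with augmented chain
-- complex C(T).  Iterated subdivision followed by f is a chain map
-- φ : C(T) → C(T), and coning at f(x) is a homotopy h with φ = ∂ h + h ∂; since
-- C(T) is finitely generated, tr(AB) = tr(BA) makes the alternating trace of φ
-- vanish.  On the other hand φ is equivariant and T is free, so its diagonal
-- entries are constant on orbits of size p; the empty simplex contributes 1,
-- and hence 0 ≡ 1 mod p.  Membership in T need not be decidable, but the goal
-- is a negation and T is finite, so decidability may be assumed.

open import Defs
open import Data.Bool using (true; false)
open import Data.Bool.Properties using () renaming (_≟_ to _≟ᵇ_)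
open import Data.Empty using (⊥; ⊥-elim)
open import Data.Fin using (Fin; zero; suc; splitAt; _↑ˡ_; _↑ʳ_)
open import Data.Fin.Properties
  using (splitAt-↑ˡ; splitAt-↑ʳ; splitAt⁻¹-↑ˡ; splitAt⁻¹-↑ʳ; ↑ˡ-injective; ↑ʳ-injective)
open import Data.Fin.Subset using (Subset; _∈_; _⊆_; ∣_∣; Nonempty; ⁅_⁆; _∪_)
  renaming (⊥ to ∅)
open import Data.Fin.Subset.Properties
  using (∪-identityˡ; ⊆-antisym; ⊆-refl; ⊆-trans; ∉⊥; x∈⁅x⁆; x∈⁅y⁆⇒x≡y; x∈p∪q⁺; x∈p∪q⁻;
         s⊆s; out⊆; ∣p∣≤n; nonempty?)
open import Data.Integer using (ℤ; 0ℤ; 1ℤ; -1ℤ; _+_; _*_; -_; ≢-nonZero)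
  renaming (+_ to pos; ∣_∣ to ∣_∣ᶻ)
import Data.Integer.Properties as ℤ
open import Data.List using (List; []; _∷_; _++_; map; filter; length; applyUpTo)
open import Data.List.Membership.Propositional using () renaming (_∈_ to _∈ₗ_; _∉_ to _∉ₗ_)
open import Data.List.Membership.Propositional.Properties
  using (∈-map⁺; ∈-map⁻; ∈-++⁺ˡ; ∈-++⁺ʳ; ∈-++⁻; ∈-filter⁺; ∈-filter⁻; ∈-applyUpTo⁺; ∈-applyUpTo⁻)
open import Data.List.Membership.Propositional.Properties.WithK using (unique∧set⇒bag)
open import Data.List.Properties using (filter-notAll)
open import Data.List.Relation.Binary.BagAndSetEquality using (∼bag⇒↭)
open import Data.List.Relation.Binary.Permutation.Propositional as ↭ using (_↭_)
open import Data.List.Relation.Unary.All as All using ([]; _∷_)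
open import Data.List.Relation.Unary.AllPairs using ([]; _∷_)
open import Data.List.Relation.Unary.Any using (here; there; any?)
open import Data.List.Relation.Unary.Unique.Propositional using (Unique)
import Data.List.Relation.Unary.Unique.Propositional.Properties as Unique
open import Data.Nat as ℕ using (ℕ; _≤_; suc; zero; z≤n; s≤s)
open import Data.Nat.Primality using (Prime; prime⇒nonTrivial)
import Data.Nat.Properties as ℕ
open import Data.Product using (Σ; ∃; _×_; _,_; proj₁; proj₂)
open import Data.Sum using (_⊎_; inj₁; inj₂)
open import Data.Unit using (tt)
open import Data.Vec using ([]; _∷_; here; there; take; drop)
open import Data.Vec.Properties using (≡-dec)
open import Function using (_∘_; id)
open import Function.Bundles using (mk⇔)
open import Relation.Binary using (DecidableEquality)
open import Relation.Binary.PropositionalEquality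
  using (_≡_; _≢_; refl; sym; trans; cong; cong₂; subst; module ≡-Reasoning)
open import Relation.Nullary using (¬_; Dec; yes; no)
open import Relation.Nullary.Decidable using (¬?; _×-dec_)

open ≡-Reasoning

-- Chains

-- Two obstacles shape the construction. Orientation signs would swamp a proof by explicit formulas;
-- in the exterior algebra one identity, `∂ (v ∧ x) ⊕ v ∧ ∂ x ≡ x`, gives the chain map property of
-- pushforward, the boundary of a subdivision and the homotopy. Scalars are only asserted to exist,
-- and the one thing ever shown about such a scalar is that it is nonzero when the vertex map is
-- invertible. The other obstacle is ghost vertices: neither the simplicial nor the equivariance
-- condition constrains `f` on them. Chains therefore live in the full simplex on all indices, where
-- most identities hold outright, and the complex enters only as a spanning condition on chains.
-- Equivariance is claimed under that condition alone, and traces run over a list of the simplices,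
-- which is where deciding membership is needed. The empty simplex is a generator of the augmented
-- complex and the only one that the group fixes; it supplies the 1 that remains modulo p.

infixr 5 _﹐_
infixl 6 _⊕_
infixr 7 _·_
infixr 7 _∧_

-- The exterior algebra on e₀, …, eₙ₋₁, which is the augmented chain complex of
-- the full simplex on n ordered vertices; a ﹐ b stands for a + e₀ ∧ b.
data Λ : ℕ → Set where
  ⟨_⟩ : ℤ → Λ 0
  _﹐_ : ∀ {n} → Λ n → Λ n → Λ (suc n)

_⊕_ : ∀ {n} → Λ n → Λ n → Λ n
⟨ c ⟩ ⊕ ⟨ d ⟩ = ⟨ c + d ⟩
(a ﹐ b) ⊕ (c ﹐ d) = (a ⊕ c) ﹐ (b ⊕ d)

_·_ : ∀ {n} → ℤ → Λ n → Λ n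
c · ⟨ d ⟩ = ⟨ c * d ⟩
c · (a ﹐ b) = c · a ﹐ c · b

𝟎 : ∀ {n} → Λ n
𝟎 {zero}  = ⟨ 0ℤ ⟩
𝟎 {suc n} = 𝟎 ﹐ 𝟎

neg : ∀ {n} → Λ n → Λ n
neg x = -1ℤ · x

basis : ∀ {n} → Subset n → Λ n
basis []          = ⟨ 1ℤ ⟩
basis (false ∷ σ) = basis σ ﹐ 𝟎
basis (true  ∷ σ) = 𝟎 ﹐ basis σ

coeff : ∀ {n} → Λ n → Subset n → ℤ
coeff ⟨ c ⟩   []          = c
coeff (a ﹐ b) (false ∷ σ) = coeff a σ
coeff (a ﹐ b) (true  ∷ σ) = coeff b σ

⊕-assoc : ∀ {n} (x y z : Λ n) → (x ⊕ y) ⊕ z ≡ x ⊕ (y ⊕ z)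
⊕-assoc ⟨ c ⟩ ⟨ d ⟩ ⟨ e ⟩ = cong ⟨_⟩ (ℤ.+-assoc c d e)
⊕-assoc (a ﹐ b) (c ﹐ d) (e ﹐ f) = cong₂ _﹐_ (⊕-assoc a c e) (⊕-assoc b d f)

⊕-comm : ∀ {n} (x y : Λ n) → x ⊕ y ≡ y ⊕ x
⊕-comm ⟨ c ⟩ ⟨ d ⟩ = cong ⟨_⟩ (ℤ.+-comm c d)
⊕-comm (a ﹐ b) (c ﹐ d) = cong₂ _﹐_ (⊕-comm a c) (⊕-comm b d)

⊕-identityˡ : ∀ {n} (x : Λ n) → 𝟎 ⊕ x ≡ x
⊕-identityˡ ⟨ c ⟩ = cong ⟨_⟩ (ℤ.+-identityˡ c)
⊕-identityˡ (a ﹐ b) = cong₂ _﹐_ (⊕-identityˡ a) (⊕-identityˡ b)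

⊕-identityʳ : ∀ {n} (x : Λ n) → x ⊕ 𝟎 ≡ x
⊕-identityʳ x = trans (⊕-comm x 𝟎) (⊕-identityˡ x)

·-distribˡ : ∀ {n} (c : ℤ) (x y : Λ n) → c · (x ⊕ y) ≡ c · x ⊕ c · y
·-distribˡ c ⟨ d ⟩ ⟨ e ⟩ = cong ⟨_⟩ (ℤ.*-distribˡ-+ c d e)
·-distribˡ c (a ﹐ b) (d ﹐ e) = cong₂ _﹐_ (·-distribˡ c a d) (·-distribˡ c b e)

·-distribʳ : ∀ {n} (c d : ℤ) (x : Λ n) → (c + d) · x ≡ c · x ⊕ d · x
·-distribʳ c d ⟨ e ⟩ = cong ⟨_⟩ (ℤ.*-distribʳ-+ e c d)
·-distribʳ c d (a ﹐ b) = cong₂ _﹐_ (·-distribʳ c d a) (·-distribʳ c d b)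

·-assoc : ∀ {n} (c d : ℤ) (x : Λ n) → (c * d) · x ≡ c · (d · x)
·-assoc c d ⟨ e ⟩ = cong ⟨_⟩ (ℤ.*-assoc c d e)
·-assoc c d (a ﹐ b) = cong₂ _﹐_ (·-assoc c d a) (·-assoc c d b)

·-comm : ∀ {n} (c d : ℤ) (x : Λ n) → c · (d · x) ≡ d · (c · x)
·-comm c d x = trans (sym (·-assoc c d x))
  (trans (cong (_· x) (ℤ.*-comm c d)) (·-assoc d c x))

1-· : ∀ {n} (x : Λ n) → 1ℤ · x ≡ x
1-· ⟨ c ⟩ = cong ⟨_⟩ (ℤ.*-identityˡ c)
1-· (a ﹐ b) = cong₂ _﹐_ (1-· a) (1-· b)

0-· : ∀ {n} (x : Λ n) → 0ℤ · x ≡ 𝟎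
0-· ⟨ c ⟩ = refl
0-· (a ﹐ b) = cong₂ _﹐_ (0-· a) (0-· b)

·-𝟎 : ∀ {n} (c : ℤ) → c · 𝟎 {n} ≡ 𝟎
·-𝟎 {zero}  c = cong ⟨_⟩ (ℤ.*-zeroʳ c)
·-𝟎 {suc n} c = cong₂ _﹐_ (·-𝟎 c) (·-𝟎 c)

neg-neg : ∀ {n} (x : Λ n) → neg (neg x) ≡ x
neg-neg x = trans (sym (·-assoc -1ℤ -1ℤ x)) (1-· x)

⊕-inverseʳ : ∀ {n} (x : Λ n) → x ⊕ neg x ≡ 𝟎
⊕-inverseʳ x = begin
  x ⊕ neg x       ≡⟨ cong (_⊕ neg x) (sym (1-· x)) ⟩
  1ℤ · x ⊕ neg x  ≡⟨ sym (·-distribʳ 1ℤ -1ℤ x) ⟩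
  0ℤ · x          ≡⟨ 0-· x ⟩
  𝟎               ∎

⊕-inverseˡ : ∀ {n} (x : Λ n) → neg x ⊕ x ≡ 𝟎
⊕-inverseˡ x = trans (⊕-comm (neg x) x) (⊕-inverseʳ x)

⊕-medial : ∀ {n} (a b c d : Λ n) → (a ⊕ b) ⊕ (c ⊕ d) ≡ (a ⊕ c) ⊕ (b ⊕ d)
⊕-medial a b c d = begin
  (a ⊕ b) ⊕ (c ⊕ d)  ≡⟨ ⊕-assoc a b (c ⊕ d) ⟩
  a ⊕ (b ⊕ (c ⊕ d))  ≡⟨ cong (a ⊕_) (sym (⊕-assoc b c d)) ⟩
  a ⊕ ((b ⊕ c) ⊕ d)  ≡⟨ cong (λ z → a ⊕ (z ⊕ d)) (⊕-comm b c) ⟩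
  a ⊕ ((c ⊕ b) ⊕ d)  ≡⟨ cong (a ⊕_) (⊕-assoc c b d) ⟩
  a ⊕ (c ⊕ (b ⊕ d))  ≡⟨ sym (⊕-assoc a c (b ⊕ d)) ⟩
  (a ⊕ c) ⊕ (b ⊕ d)  ∎

move-right : ∀ {n} {x y z : Λ n} → x ⊕ y ≡ z → x ≡ z ⊕ neg y
move-right {x = x} {y} {z} e = begin
  x                ≡⟨ sym (⊕-identityʳ x) ⟩
  x ⊕ 𝟎            ≡⟨ cong (x ⊕_) (sym (⊕-inverseʳ y)) ⟩
  x ⊕ (y ⊕ neg y)  ≡⟨ sym (⊕-assoc x y (neg y)) ⟩
  (x ⊕ y) ⊕ neg y  ≡⟨ cong (_⊕ neg y) e ⟩
  z ⊕ neg y        ∎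

-- Linear maps

record Linear {m n : ℕ} (F : Λ m → Λ n) : Set where
  field
    ⊕-homo : ∀ x y → F (x ⊕ y) ≡ F x ⊕ F y
    ·-homo : ∀ c x → F (c · x) ≡ c · F x

  𝟎-homo : F 𝟎 ≡ 𝟎
  𝟎-homo = trans (cong F (sym (0-· 𝟎))) (trans (·-homo 0ℤ 𝟎) (0-· (F 𝟎)))

open Linear

∘-linear : ∀ {l m n} {F : Λ m → Λ n} {G : Λ l → Λ m} → Linear F → Linear G → Linear (F ∘ G)
∘-linear {F = F} LF LG = record
  { ⊕-homo = λ x y → trans (cong F (⊕-homo LG x y)) (⊕-homo LF _ _)
  ; ·-homo = λ c x → trans (cong F (·-homo LG c x)) (·-homo LF c _) }

⊕-linear : ∀ {m n} {F G : Λ m → Λ n} → Linear F → Linear G → Linear (λ x → F x ⊕ G x)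
⊕-linear {F = F} {G} LF LG = record
  { ⊕-homo = λ x y → trans (cong₂ _⊕_ (⊕-homo LF x y) (⊕-homo LG x y)) (⊕-medial _ _ _ _)
  ; ·-homo = λ c x → trans (cong₂ _⊕_ (·-homo LF c x) (·-homo LG c x)) (sym (·-distribˡ c _ _)) }

id-linear : ∀ {n} → Linear {n} id
id-linear = record { ⊕-homo = λ _ _ → refl ; ·-homo = λ _ _ → refl }

·-linear : ∀ {n} (c : ℤ) → Linear {n} (c ·_)
·-linear c = record { ⊕-homo = ·-distribˡ c ; ·-homo = λ d x → ·-comm c d x }

𝟎-linear : ∀ {m n} → Linear {m} {n} (λ _ → 𝟎)
𝟎-linear = record { ⊕-homo = λ _ _ → sym (⊕-identityˡ 𝟎) ; ·-homo = λ c _ → sym (·-𝟎 c) }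

inl-linear : ∀ {n} → Linear {n} (_﹐ 𝟎)
inl-linear = record
  { ⊕-homo = λ x y → cong ((x ⊕ y) ﹐_) (sym (⊕-identityˡ 𝟎))
  ; ·-homo = λ c x → cong (c · x ﹐_) (sym (·-𝟎 c)) }

inr-linear : ∀ {n} → Linear {n} (𝟎 ﹐_)
inr-linear = record
  { ⊕-homo = λ x y → cong (_﹐ (x ⊕ y)) (sym (⊕-identityˡ 𝟎))
  ; ·-homo = λ c x → cong (_﹐ c · x) (sym (·-𝟎 c)) }

split : ∀ {n} (a b : Λ n) → a ﹐ b ≡ (a ﹐ 𝟎) ⊕ (𝟎 ﹐ b)
split a b = cong₂ _﹐_ (sym (⊕-identityʳ a)) (sym (⊕-identityˡ b))

-- An inductive witness of membership in the subspace, rather than a condition on coefficients: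
-- linear identities are then proved by induction on the witness, and `P` need not be decidable.
data Span {n : ℕ} (P : Subset n → Set) : Λ n → Set where
  s-basis : ∀ {σ} → P σ → Span P (basis σ)
  s-𝟎     : Span P 𝟎
  s-⊕     : ∀ {x y} → Span P x → Span P y → Span P (x ⊕ y)
  s-·     : ∀ c {x} → Span P x → Span P (c · x)

Span-map : ∀ {m n} {F : Λ m → Λ n} {P : Subset m → Set} {Q : Subset n → Set} →
  Linear F → (∀ {σ} → P σ → Span Q (F (basis σ))) → ∀ {x} → Span P x → Span Q (F x)
Span-map L f (s-basis p) = f p
Span-map {Q = Q} L f s-𝟎 = subst (Span Q) (sym (𝟎-homo L)) s-𝟎
Span-map {Q = Q} L f (s-⊕ s t) =
  subst (Span Q) (sym (⊕-homo L _ _)) (s-⊕ (Span-map L f s) (Span-map L f t))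
Span-map {Q = Q} L f (s-· c s) =
  subst (Span Q) (sym (·-homo L c _)) (s-· c (Span-map L f s))

Span-mono : ∀ {n} {P Q : Subset n → Set} → (∀ {σ} → P σ → Q σ) → ∀ {x} → Span P x → Span Q x
Span-mono f = Span-map id-linear (s-basis ∘ f)

-- This form, relative to `P`, serves for identities that may fail on simplices outside the complex,
-- such as equivariance of `f`.
agree-on-Span : ∀ {m n} {F G : Λ m → Λ n} {P : Subset m → Set} → Linear F → Linear G →
  (∀ {σ} → P σ → F (basis σ) ≡ G (basis σ)) → ∀ {x} → Span P x → F x ≡ G x
agree-on-Span LF LG e (s-basis p) = e p
agree-on-Span LF LG e s-𝟎 = trans (𝟎-homo LF) (sym (𝟎-homo LG))
agree-on-Span LF LG e (s-⊕ s t) = trans (⊕-homo LF _ _)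
  (trans (cong₂ _⊕_ (agree-on-Span LF LG e s) (agree-on-Span LF LG e t)) (sym (⊕-homo LG _ _)))
agree-on-Span LF LG e (s-· c s) = trans (·-homo LF c _)
  (trans (cong (c ·_) (agree-on-Span LF LG e s)) (sym (·-homo LG c _)))

-- Precomposing with `_﹐ 𝟎` and `𝟎 ﹐_` replaces the claim for n+1 vertices by two claims for n
-- vertices, down to scalars.
agree-everywhere : ∀ {m n} {F G : Λ m → Λ n} → Linear F → Linear G →
  (∀ σ → F (basis σ) ≡ G (basis σ)) → ∀ x → F x ≡ G x
agree-everywhere {F = F} {G} LF LG e ⟨ c ⟩ = begin
  F ⟨ c ⟩         ≡⟨ cong (F ∘ ⟨_⟩) (sym (ℤ.*-identityʳ c)) ⟩
  F (c · ⟨ 1ℤ ⟩)  ≡⟨ ·-homo LF c _ ⟩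
  c · F ⟨ 1ℤ ⟩    ≡⟨ cong (c ·_) (e []) ⟩
  c · G ⟨ 1ℤ ⟩    ≡⟨ sym (·-homo LG c _) ⟩
  G (c · ⟨ 1ℤ ⟩)  ≡⟨ cong (G ∘ ⟨_⟩) (ℤ.*-identityʳ c) ⟩
  G ⟨ c ⟩         ∎
agree-everywhere {F = F} {G} LF LG e (a ﹐ b) = begin
  F (a ﹐ b)                ≡⟨ cong F (split a b) ⟩
  F ((a ﹐ 𝟎) ⊕ (𝟎 ﹐ b))    ≡⟨ ⊕-homo LF _ _ ⟩
  F (a ﹐ 𝟎) ⊕ F (𝟎 ﹐ b)    ≡⟨ cong₂ _⊕_
    (agree-everywhere (∘-linear LF inl-linear) (∘-linear LG inl-linear) (e ∘ (false ∷_)) a)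
    (agree-everywhere (∘-linear LF inr-linear) (∘-linear LG inr-linear) (e ∘ (true ∷_)) b) ⟩
  G (a ﹐ 𝟎) ⊕ G (𝟎 ﹐ b)    ≡⟨ sym (⊕-homo LG _ _) ⟩
  G ((a ﹐ 𝟎) ⊕ (𝟎 ﹐ b))    ≡⟨ cong G (sym (split a b)) ⟩
  G (a ﹐ b)                ∎

extend : ∀ {m n} → (Subset m → Λ n) → Λ m → Λ n
extend f ⟨ c ⟩   = c · f []
extend f (a ﹐ b) = extend (f ∘ (false ∷_)) a ⊕ extend (f ∘ (true ∷_)) b

extend-linear : ∀ {m n} (f : Subset m → Λ n) → Linear (extend f)
extend-linear {zero} f = record
  { ⊕-homo = λ { ⟨ c ⟩ ⟨ d ⟩ → ·-distribʳ c d (f []) }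
  ; ·-homo = λ { c ⟨ d ⟩ → ·-assoc c d (f []) } }
extend-linear {suc m} f = record
  { ⊕-homo = λ { (a ﹐ b) (c ﹐ d) →
      trans (cong₂ _⊕_ (⊕-homo L₀ a c) (⊕-homo L₁ b d)) (⊕-medial _ _ _ _) }
  ; ·-homo = λ { c (a ﹐ b) →
      trans (cong₂ _⊕_ (·-homo L₀ c a) (·-homo L₁ c b)) (sym (·-distribˡ c _ _)) } }
  where
    L₀ = extend-linear (f ∘ (false ∷_))
    L₁ = extend-linear (f ∘ (true ∷_))

extend-basis : ∀ {m n} (f : Subset m → Λ n) σ → extend f (basis σ) ≡ f σ
extend-basis f [] = 1-· (f [])
extend-basis f (false ∷ σ) = trans
  (cong₂ _⊕_ (extend-basis (f ∘ (false ∷_)) σ) (𝟎-homo (extend-linear (f ∘ (true ∷_))))) (⊕-identityʳ _)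
extend-basis f (true ∷ σ) = trans
  (cong₂ _⊕_ (𝟎-homo (extend-linear (f ∘ (false ∷_)))) (extend-basis (f ∘ (true ∷_)) σ)) (⊕-identityˡ _)

-- Boundary, exterior multiplication by a vertex, and pushforward

-- Contraction with the functional that takes the value 1 on every vertex: the antiderivation rule
-- gives ∂(e₀ ∧ b) = b - e₀ ∧ ∂b. A single vertex has boundary `basis ∅`, which is the augmentation.
∂ : ∀ {n} → Λ n → Λ n
∂ ⟨ c ⟩   = 𝟎
∂ (a ﹐ b) = (∂ a ⊕ b) ﹐ neg (∂ b)

_∧_ : ∀ {n} → Fin n → Λ n → Λ n
zero  ∧ (a ﹐ b) = 𝟎 ﹐ a
suc v ∧ (a ﹐ b) = v ∧ a ﹐ neg (v ∧ b)

-- The homomorphism of exterior algebras induced by `f`. A simplex on which `f` is not injective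
-- goes to 𝟎, because a repeated factor squares to zero; no case distinction is needed.
push : ∀ {m n} → (Fin m → Fin n) → Λ m → Λ n
push f ⟨ c ⟩   = c · basis ∅
push f (a ﹐ b) = push (f ∘ suc) a ⊕ f zero ∧ push (f ∘ suc) b

-- Multiplies the basis element of σ by (-1)^|σ|; traces of F ∘ ε are alternating traces.
ε : ∀ {n} → Λ n → Λ n
ε ⟨ c ⟩   = ⟨ c ⟩
ε (a ﹐ b) = ε a ﹐ neg (ε b)

neg-∘-linear : ∀ {m n} {F : Λ m → Λ n} → Linear F → Linear (neg ∘ F)
neg-∘-linear = ∘-linear (·-linear -1ℤ)

∂-linear : ∀ {n} → Linear (∂ {n})
∂-linear {zero} = record
  { ⊕-homo = λ { ⟨ c ⟩ ⟨ d ⟩ → refl }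
  ; ·-homo = λ { c ⟨ d ⟩ → sym (·-𝟎 c) } }
∂-linear {suc n} = record
  { ⊕-homo = λ { (a ﹐ b) (c ﹐ d) → cong₂ _﹐_
      (trans (cong (_⊕ (b ⊕ d)) (⊕-homo ∂-linear a c)) (⊕-medial _ _ _ _))
      (⊕-homo (neg-∘-linear ∂-linear) b d) }
  ; ·-homo = λ { c (a ﹐ b) → cong₂ _﹐_
      (trans (cong (_⊕ c · b) (·-homo ∂-linear c a)) (sym (·-distribˡ c _ _)))
      (·-homo (neg-∘-linear ∂-linear) c b) } }

∧-linear : ∀ {n} (v : Fin n) → Linear (v ∧_)
∧-linear zero = record
  { ⊕-homo = λ { (a ﹐ b) (c ﹐ d) → cong (_﹐ (a ⊕ c)) (sym (⊕-identityˡ 𝟎)) }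
  ; ·-homo = λ { c (a ﹐ b) → cong (_﹐ c · a) (sym (·-𝟎 c)) } }
∧-linear (suc v) = record
  { ⊕-homo = λ { (a ﹐ b) (c ﹐ d) → cong₂ _﹐_
      (⊕-homo (∧-linear v) a c) (⊕-homo (neg-∘-linear (∧-linear v)) b d) }
  ; ·-homo = λ { c (a ﹐ b) → cong₂ _﹐_
      (·-homo (∧-linear v) c a) (·-homo (neg-∘-linear (∧-linear v)) c b) } }

push-linear : ∀ {m n} (f : Fin m → Fin n) → Linear (push f)
push-linear {zero} f = record
  { ⊕-homo = λ { ⟨ c ⟩ ⟨ d ⟩ → ·-distribʳ c d _ }
  ; ·-homo = λ { c ⟨ d ⟩ → ·-assoc c d _ } }
push-linear {suc m} f = record
  { ⊕-homo = λ { (a ﹐ b) (c ﹐ d) →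
      trans (cong₂ _⊕_ (⊕-homo L₀ a c) (⊕-homo L₁ b d)) (⊕-medial _ _ _ _) }
  ; ·-homo = λ { c (a ﹐ b) →
      trans (cong₂ _⊕_ (·-homo L₀ c a) (·-homo L₁ c b)) (sym (·-distribˡ c _ _)) } }
  where
    L₀ = push-linear (f ∘ suc)
    L₁ = ∘-linear (∧-linear (f zero)) L₀

ε-linear : ∀ {n} → Linear (ε {n})
ε-linear {zero} = record
  { ⊕-homo = λ { ⟨ c ⟩ ⟨ d ⟩ → refl }
  ; ·-homo = λ { c ⟨ d ⟩ → refl } }
ε-linear {suc n} = record
  { ⊕-homo = λ { (a ﹐ b) (c ﹐ d) → cong₂ _﹐_
      (⊕-homo ε-linear a c) (⊕-homo (neg-∘-linear ε-linear) b d) }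
  ; ·-homo = λ { c (a ﹐ b) → cong₂ _﹐_
      (·-homo ε-linear c a) (·-homo (neg-∘-linear ε-linear) c b) } }

neg-homo : ∀ {m n} {F : Λ m → Λ n} → Linear F → ∀ x → F (neg x) ≡ neg (F x)
neg-homo L = ·-homo L -1ℤ

∂∂≡𝟎 : ∀ {n} (x : Λ n) → ∂ (∂ x) ≡ 𝟎
∂∂≡𝟎 ⟨ c ⟩ = refl
∂∂≡𝟎 (a ﹐ b) = cong₂ _﹐_
  (begin
    ∂ (∂ a ⊕ b) ⊕ neg (∂ b)        ≡⟨ cong (_⊕ neg (∂ b)) (⊕-homo ∂-linear (∂ a) b) ⟩
    (∂ (∂ a) ⊕ ∂ b) ⊕ neg (∂ b)    ≡⟨ cong (λ z → (z ⊕ ∂ b) ⊕ neg (∂ b)) (∂∂≡𝟎 a) ⟩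
    (𝟎 ⊕ ∂ b) ⊕ neg (∂ b)          ≡⟨ cong (_⊕ neg (∂ b)) (⊕-identityˡ (∂ b)) ⟩
    ∂ b ⊕ neg (∂ b)                ≡⟨ ⊕-inverseʳ (∂ b) ⟩
    𝟎                              ∎)
  (begin
    neg (∂ (neg (∂ b)))  ≡⟨ cong neg (neg-homo ∂-linear (∂ b)) ⟩
    neg (neg (∂ (∂ b)))  ≡⟨ neg-neg _ ⟩
    ∂ (∂ b)              ≡⟨ ∂∂≡𝟎 b ⟩
    𝟎                    ∎)

-- The antiderivation rule for a vertex, whose boundary is 1. It says that multiplication by any `v`
-- contracts the augmented complex of the full simplex.
∂-∧ : ∀ {n} (v : Fin n) (x : Λ n) → ∂ (v ∧ x) ⊕ v ∧ ∂ x ≡ x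
∂-∧ zero (a ﹐ b) = cong₂ _﹐_
  (begin
    (∂ 𝟎 ⊕ a) ⊕ 𝟎  ≡⟨ ⊕-identityʳ _ ⟩
    ∂ 𝟎 ⊕ a        ≡⟨ cong (_⊕ a) (𝟎-homo ∂-linear) ⟩
    𝟎 ⊕ a          ≡⟨ ⊕-identityˡ a ⟩
    a              ∎)
  (begin
    neg (∂ a) ⊕ (∂ a ⊕ b)  ≡⟨ sym (⊕-assoc _ _ _) ⟩
    (neg (∂ a) ⊕ ∂ a) ⊕ b  ≡⟨ cong (_⊕ b) (⊕-inverseˡ (∂ a)) ⟩
    𝟎 ⊕ b                  ≡⟨ ⊕-identityˡ b ⟩
    b                      ∎)
∂-∧ (suc v) (a ﹐ b) = cong₂ _﹐_
  (begin
    (∂ (v ∧ a) ⊕ neg (v ∧ b)) ⊕ v ∧ (∂ a ⊕ b)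
      ≡⟨ cong ((∂ (v ∧ a) ⊕ neg (v ∧ b)) ⊕_) (⊕-homo (∧-linear v) (∂ a) b) ⟩
    (∂ (v ∧ a) ⊕ neg (v ∧ b)) ⊕ (v ∧ ∂ a ⊕ v ∧ b)
      ≡⟨ ⊕-medial _ _ _ _ ⟩
    (∂ (v ∧ a) ⊕ v ∧ ∂ a) ⊕ (neg (v ∧ b) ⊕ v ∧ b)
      ≡⟨ cong₂ _⊕_ (∂-∧ v a) (⊕-inverseˡ (v ∧ b)) ⟩
    a ⊕ 𝟎
      ≡⟨ ⊕-identityʳ a ⟩
    a ∎)
  (begin
    neg (∂ (neg (v ∧ b))) ⊕ neg (v ∧ neg (∂ b))
      ≡⟨ cong₂ (λ x y → neg x ⊕ neg y) (neg-homo ∂-linear (v ∧ b)) (neg-homo (∧-linear v) (∂ b)) ⟩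
    neg (neg (∂ (v ∧ b))) ⊕ neg (neg (v ∧ ∂ b))
      ≡⟨ cong₂ _⊕_ (neg-neg _) (neg-neg _) ⟩
    ∂ (v ∧ b) ⊕ v ∧ ∂ b
      ≡⟨ ∂-∧ v b ⟩
    b ∎)

∂-∧′ : ∀ {n} (v : Fin n) (x : Λ n) → ∂ (v ∧ x) ≡ x ⊕ neg (v ∧ ∂ x)
∂-∧′ v x = move-right (∂-∧ v x)

∧-square : ∀ {n} (v : Fin n) (x : Λ n) → v ∧ v ∧ x ≡ 𝟎
∧-square zero (a ﹐ b) = refl
∧-square (suc v) (a ﹐ b) = cong₂ _﹐_ (∧-square v a)
  (begin
    neg (v ∧ neg (v ∧ b))  ≡⟨ cong neg (neg-homo (∧-linear v) (v ∧ b)) ⟩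
    neg (neg (v ∧ v ∧ b))  ≡⟨ neg-neg _ ⟩
    v ∧ v ∧ b              ≡⟨ ∧-square v b ⟩
    𝟎                      ∎)

∧-anticomm : ∀ {n} (v w : Fin n) (x : Λ n) → v ∧ w ∧ x ≡ neg (w ∧ v ∧ x)
∧-anticomm zero zero (a ﹐ b) = cong₂ _﹐_ (sym (·-𝟎 -1ℤ)) (sym (·-𝟎 -1ℤ))
∧-anticomm zero (suc w) (a ﹐ b) = cong₂ _﹐_
  (trans (sym (·-𝟎 -1ℤ)) (cong neg (sym (𝟎-homo (∧-linear w)))))
  (sym (neg-neg _))
∧-anticomm (suc v) zero (a ﹐ b) = cong₂ _﹐_
  (trans (𝟎-homo (∧-linear v)) (sym (·-𝟎 -1ℤ)))
  refl
∧-anticomm (suc v) (suc w) (a ﹐ b) = cong₂ _﹐_ (∧-anticomm v w a)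
  (cong neg (begin
    v ∧ neg (w ∧ b)        ≡⟨ neg-homo (∧-linear v) _ ⟩
    neg (v ∧ w ∧ b)        ≡⟨ cong neg (∧-anticomm v w b) ⟩
    neg (neg (w ∧ v ∧ b))  ≡⟨ cong neg (sym (neg-homo (∧-linear w) _)) ⟩
    neg (w ∧ neg (v ∧ b))  ∎))

push-∅ : ∀ {m n} (f : Fin m → Fin n) → push f (basis ∅) ≡ basis ∅
push-∅ {zero} f = 1-· _
push-∅ {suc m} f = begin
  push (f ∘ suc) (basis ∅) ⊕ f zero ∧ push (f ∘ suc) 𝟎
    ≡⟨ cong₂ _⊕_ (push-∅ (f ∘ suc))
         (𝟎-homo (∘-linear (∧-linear (f zero)) (push-linear (f ∘ suc)))) ⟩
  basis ∅ ⊕ 𝟎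
    ≡⟨ ⊕-identityʳ _ ⟩
  basis ∅ ∎

push-∧ : ∀ {m n} (f : Fin m → Fin n) v x → push f (v ∧ x) ≡ f v ∧ push f x
push-∧ f zero (a ﹐ b) = begin
  push f′ 𝟎 ⊕ f zero ∧ push f′ a
    ≡⟨ cong (_⊕ f zero ∧ push f′ a) (𝟎-homo (push-linear f′)) ⟩
  𝟎 ⊕ f zero ∧ push f′ a
    ≡⟨ ⊕-comm _ _ ⟩
  f zero ∧ push f′ a ⊕ 𝟎
    -- The target has a further term containing `f zero` twice; it vanishes, so it may be inserted.
    ≡⟨ cong (f zero ∧ push f′ a ⊕_) (sym (∧-square (f zero) (push f′ b))) ⟩
  f zero ∧ push f′ a ⊕ f zero ∧ f zero ∧ push f′ b
    ≡⟨ sym (⊕-homo (∧-linear (f zero)) _ _) ⟩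
  f zero ∧ (push f′ a ⊕ f zero ∧ push f′ b) ∎
  where f′ = f ∘ suc
push-∧ f (suc v) (a ﹐ b) = begin
  push f′ (v ∧ a) ⊕ f zero ∧ push f′ (neg (v ∧ b))
    ≡⟨ cong₂ (λ x y → x ⊕ f zero ∧ y) (push-∧ f′ v a)
         (trans (neg-homo (push-linear f′) (v ∧ b)) (cong neg (push-∧ f′ v b))) ⟩
  w ∧ push f′ a ⊕ f zero ∧ neg (w ∧ push f′ b)
    ≡⟨ cong (w ∧ push f′ a ⊕_) (neg-homo (∧-linear (f zero)) _) ⟩
  w ∧ push f′ a ⊕ neg (f zero ∧ w ∧ push f′ b)
    ≡⟨ cong (w ∧ push f′ a ⊕_) (sym (∧-anticomm w (f zero) _)) ⟩
  w ∧ push f′ a ⊕ w ∧ f zero ∧ push f′ b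
    ≡⟨ sym (⊕-homo (∧-linear w) _ _) ⟩
  w ∧ (push f′ a ⊕ f zero ∧ push f′ b) ∎
  where
    f′ = f ∘ suc
    w  = f (suc v)

push-∘ : ∀ {l m n} (g : Fin m → Fin n) (f : Fin l → Fin m) x → push g (push f x) ≡ push (g ∘ f) x
push-∘ g f ⟨ c ⟩ = trans (·-homo (push-linear g) c (basis ∅)) (cong (c ·_) (push-∅ g))
push-∘ g f (a ﹐ b) = begin
  push g (push (f ∘ suc) a ⊕ f zero ∧ push (f ∘ suc) b)
    ≡⟨ ⊕-homo (push-linear g) (push (f ∘ suc) a) (f zero ∧ push (f ∘ suc) b) ⟩
  push g (push (f ∘ suc) a) ⊕ push g (f zero ∧ push (f ∘ suc) b)
    ≡⟨ cong₂ _⊕_ (push-∘ g (f ∘ suc) a)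
         (trans (push-∧ g (f zero) _) (cong (g (f zero) ∧_) (push-∘ g (f ∘ suc) b))) ⟩
  push (g ∘ f) (a ﹐ b) ∎

-- Agreement is asked only at vertices of `σ`, since the equivariance of `f` says nothing at ghost
-- vertices.
push-cong : ∀ {m n} {f g : Fin m → Fin n} σ → (∀ {v} → v ∈ σ → f v ≡ g v) →
  push f (basis σ) ≡ push g (basis σ)
push-cong [] e = refl
push-cong {f = f} {g} (false ∷ σ) e = cong₂ _⊕_ (push-cong σ (e ∘ there))
  (trans (𝟎-homo (∘-linear (∧-linear (f zero)) (push-linear (f ∘ suc))))
    (sym (𝟎-homo (∘-linear (∧-linear (g zero)) (push-linear (g ∘ suc))))))
push-cong {f = f} {g} (true ∷ σ) e = cong₂ _⊕_
  (trans (𝟎-homo (push-linear (f ∘ suc))) (sym (𝟎-homo (push-linear (g ∘ suc)))))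
  (cong₂ _∧_ (e here) (push-cong σ (e ∘ there)))

∂-∅ : ∀ {n} → ∂ (basis (∅ {n})) ≡ 𝟎
∂-∅ {zero} = refl
∂-∅ {suc n} = cong₂ _﹐_ (trans (⊕-identityʳ _) ∂-∅)
  (trans (cong neg (𝟎-homo ∂-linear)) (·-𝟎 -1ℤ))

∂-push : ∀ {m n} (f : Fin m → Fin n) x → ∂ (push f x) ≡ push f (∂ x)
∂-push f ⟨ c ⟩ = trans (·-homo ∂-linear c (basis ∅)) (trans (cong (c ·_) ∂-∅)
  (trans (·-𝟎 c) (sym (𝟎-homo (push-linear f)))))
∂-push f (a ﹐ b) = begin
  ∂ (push f′ a ⊕ f zero ∧ push f′ b)
    ≡⟨ ⊕-homo ∂-linear (push f′ a) (f zero ∧ push f′ b) ⟩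
  ∂ (push f′ a) ⊕ ∂ (f zero ∧ push f′ b)
    ≡⟨ cong (∂ (push f′ a) ⊕_) (∂-∧′ (f zero) _) ⟩
  ∂ (push f′ a) ⊕ (push f′ b ⊕ neg (f zero ∧ ∂ (push f′ b)))
    ≡⟨ sym (⊕-assoc _ _ _) ⟩
  (∂ (push f′ a) ⊕ push f′ b) ⊕ neg (f zero ∧ ∂ (push f′ b))
    ≡⟨ cong₂ (λ y z → (y ⊕ push f′ b) ⊕ neg (f zero ∧ z)) (∂-push f′ a) (∂-push f′ b) ⟩
  (push f′ (∂ a) ⊕ push f′ b) ⊕ neg (f zero ∧ push f′ (∂ b))
    ≡⟨ cong₂ _⊕_ (sym (⊕-homo (push-linear f′) (∂ a) b))
         (sym (neg-homo (∘-linear (∧-linear (f zero)) (push-linear f′)) (∂ b))) ⟩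
  push f′ (∂ a ⊕ b) ⊕ f zero ∧ push f′ (neg (∂ b)) ∎
  where f′ = f ∘ suc

ε-∂ : ∀ {n} (x : Λ n) → ε (∂ x) ≡ neg (∂ (ε x))
ε-∂ ⟨ c ⟩ = refl
ε-∂ (a ﹐ b) = cong₂ _﹐_
  (begin
    ε (∂ a ⊕ b)                      ≡⟨ ⊕-homo ε-linear _ _ ⟩
    ε (∂ a) ⊕ ε b                    ≡⟨ cong₂ _⊕_ (ε-∂ a) (sym (neg-neg _)) ⟩
    neg (∂ (ε a)) ⊕ neg (neg (ε b))  ≡⟨ sym (·-distribˡ -1ℤ _ _) ⟩
    neg (∂ (ε a) ⊕ neg (ε b))        ∎)
  (cong neg (begin
    ε (neg (∂ b))    ≡⟨ neg-homo ε-linear _ ⟩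
    neg (ε (∂ b))    ≡⟨ cong neg (ε-∂ b) ⟩
    neg (neg (∂ (ε b)))  ≡⟨ cong neg (sym (neg-homo ∂-linear (ε b))) ⟩
    neg (∂ (neg (ε b)))  ∎))

ε-∧ : ∀ {n} v (x : Λ n) → ε (v ∧ x) ≡ neg (v ∧ ε x)
ε-∧ zero (a ﹐ b) = cong (_﹐ neg (ε a)) (trans (𝟎-homo ε-linear) (sym (·-𝟎 -1ℤ)))
ε-∧ (suc v) (a ﹐ b) = cong₂ _﹐_ (ε-∧ v a) (cong neg (begin
  ε (neg (v ∧ b))        ≡⟨ neg-homo ε-linear _ ⟩
  neg (ε (v ∧ b))        ≡⟨ cong neg (ε-∧ v b) ⟩
  neg (neg (v ∧ ε b))    ≡⟨ cong neg (sym (neg-homo (∧-linear v) _)) ⟩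
  neg (v ∧ neg (ε b))    ∎))

ε-∅ : ∀ {n} → ε (basis (∅ {n})) ≡ basis ∅
ε-∅ {zero} = refl
ε-∅ {suc n} = cong₂ _﹐_ ε-∅ (trans (cong neg (𝟎-homo ε-linear)) (·-𝟎 -1ℤ))

ε-push : ∀ {m n} (f : Fin m → Fin n) x → ε (push f x) ≡ push f (ε x)
ε-push f ⟨ c ⟩ = trans (·-homo ε-linear c _) (cong (c ·_) ε-∅)
ε-push f (a ﹐ b) = begin
  ε (push f′ a ⊕ f zero ∧ push f′ b)
    ≡⟨ ⊕-homo ε-linear _ _ ⟩
  ε (push f′ a) ⊕ ε (f zero ∧ push f′ b)
    ≡⟨ cong₂ _⊕_ (ε-push f′ a) (trans (ε-∧ (f zero) _) (cong (neg ∘ (f zero ∧_)) (ε-push f′ b))) ⟩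
  push f′ (ε a) ⊕ neg (f zero ∧ push f′ (ε b))
    ≡⟨ cong (push f′ (ε a) ⊕_) (sym (neg-homo (∘-linear (∧-linear (f zero)) (push-linear f′)) (ε b))) ⟩
  push f′ (ε a) ⊕ f zero ∧ push f′ (neg (ε b)) ∎
  where f′ = f ∘ suc

push-suc : ∀ {m n} (f : Fin m → Fin n) x → push (suc ∘ f) x ≡ push f x ﹐ 𝟎
push-suc f ⟨ c ⟩ = cong (c · basis ∅ ﹐_) (·-𝟎 c)
push-suc f (a ﹐ b) = begin
  push (suc ∘ f ∘ suc) a ⊕ suc (f zero) ∧ push (suc ∘ f ∘ suc) b
    ≡⟨ cong₂ (λ y z → y ⊕ suc (f zero) ∧ z) (push-suc (f ∘ suc) a) (push-suc (f ∘ suc) b) ⟩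
  push f (a ﹐ b) ﹐ 𝟎 ⊕ neg (f zero ∧ 𝟎)
    ≡⟨ cong (push f (a ﹐ b) ﹐_) (trans (⊕-identityˡ _)
         (trans (cong neg (𝟎-homo (∧-linear (f zero)))) (·-𝟎 -1ℤ))) ⟩
  push f (a ﹐ b) ﹐ 𝟎 ∎

push-id : ∀ {n} (x : Λ n) → push id x ≡ x
push-id ⟨ c ⟩ = cong ⟨_⟩ (ℤ.*-identityʳ c)
push-id (a ﹐ b) = begin
  push suc a ⊕ zero ∧ push suc b
    ≡⟨ cong₂ (λ y z → y ⊕ zero ∧ z) (push-suc id a) (push-suc id b) ⟩
  (push id a ﹐ 𝟎) ⊕ (𝟎 ﹐ push id b)
    ≡⟨ cong₂ (λ y z → (y ﹐ 𝟎) ⊕ (𝟎 ﹐ z)) (push-id a) (push-id b) ⟩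
  (a ﹐ 𝟎) ⊕ (𝟎 ﹐ b)
    ≡⟨ sym (split a b) ⟩
  a ﹐ b ∎

-- Images of simplices

∈-img⁺ : ∀ {m n} (f : Fin m → Fin n) {σ v} → v ∈ σ → f v ∈ img f σ
∈-img⁺ f {true ∷ σ}  here      = x∈p∪q⁺ (inj₁ (x∈⁅x⁆ (f zero)))
∈-img⁺ f {true ∷ σ}  (there p) = x∈p∪q⁺ (inj₂ (∈-img⁺ (f ∘ suc) p))
∈-img⁺ f {false ∷ σ} (there p) = ∈-img⁺ (f ∘ suc) p

∈-img⁻ : ∀ {m n} (f : Fin m → Fin n) σ {w} → w ∈ img f σ → ∃ λ v → v ∈ σ × f v ≡ w
∈-img⁻ f [] p = ⊥-elim (∉⊥ p)
∈-img⁻ f (false ∷ σ) p with ∈-img⁻ (f ∘ suc) σ p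
... | v , q , e = suc v , there q , e
∈-img⁻ f (true ∷ σ) p with x∈p∪q⁻ ⁅ f zero ⁆ (img (f ∘ suc) σ) p
... | inj₁ q = zero , here , sym (x∈⁅y⁆⇒x≡y (f zero) q)
... | inj₂ q with ∈-img⁻ (f ∘ suc) σ q
...   | v , r , e = suc v , there r , e

img-cong : ∀ {m n} {f g : Fin m → Fin n} → (∀ v → f v ≡ g v) → ∀ σ → img f σ ≡ img g σ
img-cong e []          = refl
img-cong e (true ∷ σ)  = cong₂ _∪_ (cong ⁅_⁆ (e zero)) (img-cong (e ∘ suc) σ)
img-cong e (false ∷ σ) = img-cong (e ∘ suc) σ

img-∘ : ∀ {l m n} (g : Fin m → Fin n) (f : Fin l → Fin m) σ → img g (img f σ) ≡ img (g ∘ f) σ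
img-∘ g f σ = ⊆-antisym to from
  where
    to : img g (img f σ) ⊆ img (g ∘ f) σ
    to p with ∈-img⁻ g (img f σ) p
    ... | v , q , refl with ∈-img⁻ f σ q
    ...   | u , r , refl = ∈-img⁺ (g ∘ f) r
    from : img (g ∘ f) σ ⊆ img g (img f σ)
    from p with ∈-img⁻ (g ∘ f) σ p
    ... | v , q , refl = ∈-img⁺ g (∈-img⁺ f q)

img-id : ∀ {n} {f : Fin n → Fin n} → (∀ v → f v ≡ v) → ∀ σ → img f σ ≡ σ
img-id {f = f} e σ = ⊆-antisym to from
  where
    to : img f σ ⊆ σ
    to p with ∈-img⁻ f σ p
    ... | v , q , refl = subst (_∈ σ) (sym (e v)) q
    from : σ ⊆ img f σ
    from {v} p = subst (_∈ img f σ) (e v) (∈-img⁺ f p)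

img-⁅⁆ : ∀ {m n} (f : Fin m → Fin n) v → img f ⁅ v ⁆ ≡ ⁅ f v ⁆
img-⁅⁆ f v = ⊆-antisym to from
  where
    to : img f ⁅ v ⁆ ⊆ ⁅ f v ⁆
    to p with ∈-img⁻ f ⁅ v ⁆ p
    ... | w , q , refl rewrite x∈⁅y⁆⇒x≡y v q = x∈⁅x⁆ (f v)
    from : ⁅ f v ⁆ ⊆ img f ⁅ v ⁆
    from p rewrite x∈⁅y⁆⇒x≡y (f v) p = ∈-img⁺ f (x∈⁅x⁆ v)

img-nonempty : ∀ {m n} (f : Fin m → Fin n) {σ} → Nonempty σ → Nonempty (img f σ)
img-nonempty f (v , p) = f v , ∈-img⁺ f p

∅-or-nonempty : ∀ {n} (σ : Subset n) → σ ≡ ∅ ⊎ Nonempty σ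
∅-or-nonempty [] = inj₁ refl
∅-or-nonempty (true ∷ σ) = inj₂ (zero , here)
∅-or-nonempty (false ∷ σ) with ∅-or-nonempty σ
... | inj₁ refl    = inj₁ refl
... | inj₂ (v , p) = inj₂ (suc v , there p)

-- Effect on basis elements

coeff-⊕ : ∀ {n} (x y : Λ n) σ → coeff (x ⊕ y) σ ≡ coeff x σ + coeff y σ
coeff-⊕ ⟨ c ⟩ ⟨ d ⟩ [] = refl
coeff-⊕ (a ﹐ b) (c ﹐ d) (false ∷ σ) = coeff-⊕ a c σ
coeff-⊕ (a ﹐ b) (c ﹐ d) (true ∷ σ)  = coeff-⊕ b d σ

coeff-· : ∀ {n} c (x : Λ n) σ → coeff (c · x) σ ≡ c * coeff x σ
coeff-· c ⟨ d ⟩ [] = refl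
coeff-· c (a ﹐ b) (false ∷ σ) = coeff-· c a σ
coeff-· c (a ﹐ b) (true ∷ σ)  = coeff-· c b σ

coeff-𝟎 : ∀ {n} (σ : Subset n) → coeff 𝟎 σ ≡ 0ℤ
coeff-𝟎 []          = refl
coeff-𝟎 (false ∷ σ) = coeff-𝟎 σ
coeff-𝟎 (true ∷ σ)  = coeff-𝟎 σ

coeff-basis-≡ : ∀ {n} (σ : Subset n) → coeff (basis σ) σ ≡ 1ℤ
coeff-basis-≡ []          = refl
coeff-basis-≡ (false ∷ σ) = coeff-basis-≡ σ
coeff-basis-≡ (true ∷ σ)  = coeff-basis-≡ σ

coeff-basis-≢ : ∀ {n} {σ τ : Subset n} → σ ≢ τ → coeff (basis σ) τ ≡ 0ℤ
coeff-basis-≢ {σ = []}        {[]}        σ≢τ = ⊥-elim (σ≢τ refl)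
coeff-basis-≢ {σ = false ∷ σ} {false ∷ τ} σ≢τ = coeff-basis-≢ (σ≢τ ∘ cong (false ∷_))
coeff-basis-≢ {σ = false ∷ σ} {true ∷ τ}  σ≢τ = coeff-𝟎 τ
coeff-basis-≢ {σ = true ∷ σ}  {false ∷ τ} σ≢τ = coeff-𝟎 τ
coeff-basis-≢ {σ = true ∷ σ}  {true ∷ τ}  σ≢τ = coeff-basis-≢ (σ≢τ ∘ cong (true ∷_))

·-basis-false : ∀ {n} c (σ : Subset n) → c · basis (false ∷ σ) ≡ c · basis σ ﹐ 𝟎
·-basis-false c σ = cong (c · basis σ ﹐_) (·-𝟎 c)

·-basis-true : ∀ {n} c (σ : Subset n) → c · basis (true ∷ σ) ≡ 𝟎 ﹐ c · basis σ
·-basis-true c σ = cong (_﹐ c · basis σ) (·-𝟎 c)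

-- The scalar is 0 if `v` already lies in `σ` and a sign otherwise. Its value is left unspecified:
-- knowing which basis element occurs is enough to locate the support.
∧-basis : ∀ {n} v (σ : Subset n) → ∃ λ s → v ∧ basis σ ≡ s · basis (⁅ v ⁆ ∪ σ)
∧-basis zero (false ∷ σ) =
  1ℤ , trans (cong (λ τ → basis (true ∷ τ)) (sym (∪-identityˡ σ))) (sym (1-· _))
∧-basis zero (true ∷ σ) = 0ℤ , sym (0-· (basis (true ∷ (∅ ∪ σ))))
∧-basis (suc v) (false ∷ σ) with ∧-basis v σ
... | s , e = s , trans
  (cong₂ _﹐_ e (trans (cong neg (𝟎-homo (∧-linear v))) (·-𝟎 -1ℤ)))
  (sym (·-basis-false s _))
∧-basis (suc v) (true ∷ σ) with ∧-basis v σ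
... | s , e = -1ℤ * s , trans
  (cong₂ _﹐_ (𝟎-homo (∧-linear v)) (trans (cong neg e) (sym (·-assoc -1ℤ s _))))
  (sym (·-basis-true (-1ℤ * s) _))

push-basis : ∀ {m n} (f : Fin m → Fin n) σ → ∃ λ s → push f (basis σ) ≡ s · basis (img f σ)
push-basis f [] = 1ℤ , refl
push-basis f (false ∷ σ) with push-basis (f ∘ suc) σ
... | s , e = s , (begin
  push (f ∘ suc) (basis σ) ⊕ f zero ∧ push (f ∘ suc) 𝟎
    ≡⟨ cong₂ _⊕_ e (𝟎-homo (∘-linear (∧-linear (f zero)) (push-linear (f ∘ suc)))) ⟩
  s · basis (img (f ∘ suc) σ) ⊕ 𝟎
    ≡⟨ ⊕-identityʳ _ ⟩
  s · basis (img (f ∘ suc) σ) ∎)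
push-basis f (true ∷ σ) with push-basis (f ∘ suc) σ
... | s , e with ∧-basis (f zero) (img (f ∘ suc) σ)
...   | t , e′ = s * t , (begin
  push (f ∘ suc) 𝟎 ⊕ f zero ∧ push (f ∘ suc) (basis σ)
    ≡⟨ cong₂ _⊕_ (𝟎-homo (push-linear (f ∘ suc))) (cong (f zero ∧_) e) ⟩
  𝟎 ⊕ f zero ∧ s · basis (img (f ∘ suc) σ)
    ≡⟨ ⊕-identityˡ _ ⟩
  f zero ∧ s · basis (img (f ∘ suc) σ)
    ≡⟨ ·-homo (∧-linear (f zero)) s _ ⟩
  s · f zero ∧ basis (img (f ∘ suc) σ)
    ≡⟨ cong (s ·_) e′ ⟩
  s · t · basis (img f (true ∷ σ))
    ≡⟨ sym (·-assoc s t _) ⟩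
  (s * t) · basis (img f (true ∷ σ)) ∎)

∧-basis-Span : ∀ {n} v {σ} {P : Subset n → Set} → P (⁅ v ⁆ ∪ σ) → Span P (v ∧ basis σ)
∧-basis-Span v {σ} {P} p with ∧-basis v σ
... | s , e = subst (Span P) (sym e) (s-· s (s-basis p))

push-basis-Span : ∀ {m n} (f : Fin m → Fin n) {σ} {P : Subset n → Set} →
  P (img f σ) → Span P (push f (basis σ))
push-basis-Span f {σ} {P} p with push-basis f σ
... | s , e = subst (Span P) (sym e) (s-· s (s-basis p))

∂-basis-Span : ∀ {n} (σ : Subset n) → Span (λ τ → IsFacet τ σ) (∂ (basis σ))
∂-basis-Span [] = s-𝟎
∂-basis-Span (false ∷ σ) = subst (Span _)
  (cong₂ _﹐_ (sym (⊕-identityʳ _)) (sym (trans (cong neg (𝟎-homo ∂-linear)) (·-𝟎 -1ℤ))))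
  (Span-map inl-linear (λ (τ⊆σ , c) → s-basis (s⊆s τ⊆σ , c)) (∂-basis-Span σ))
∂-basis-Span (true ∷ σ) = subst (Span _) eq
  (s-⊕ (s-basis {σ = false ∷ σ} (out⊆ ⊆-refl , refl))
       (s-· -1ℤ (Span-map inr-linear (λ (τ⊆σ , c) → s-basis (s⊆s τ⊆σ , cong suc c))
         (∂-basis-Span σ))))
  where
    eq : (basis σ ﹐ 𝟎) ⊕ neg (𝟎 ﹐ ∂ (basis σ)) ≡ ∂ (basis (true ∷ σ))
    eq = cong₂ _﹐_
      (trans (cong (basis σ ⊕_) (·-𝟎 -1ℤ)) (trans (⊕-comm (basis σ) 𝟎)
        (cong (_⊕ basis σ) (sym (𝟎-homo ∂-linear)))))
      (⊕-identityˡ _)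

-- Barycentric subdivision

toSub-fromSub : ∀ {n} (σ : Subset n) → toSub n (fromSub σ) ≡ σ
toSub-fromSub [] = refl
toSub-fromSub {suc n} (false ∷ σ)
  rewrite splitAt-↑ˡ (2 ℕ.^ n) (fromSub σ) (2 ℕ.^ n ℕ.+ 0) = cong (false ∷_) (toSub-fromSub σ)
toSub-fromSub {suc n} (true ∷ σ)
  rewrite splitAt-↑ʳ (2 ℕ.^ n) (2 ℕ.^ n ℕ.+ 0) (fromSub σ ↑ˡ 0)
        | splitAt-↑ˡ (2 ℕ.^ n) (fromSub σ) 0 = cong (true ∷_) (toSub-fromSub σ)

BdMap : ∀ {m n} → (Fin m → Fin n) → Fin (2 ℕ.^ m) → Fin (2 ℕ.^ n)
BdMap {m} g i = fromSub (img g (toSub m i))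

-- The subdivision of σ is the cone from the barycentre of σ over the
-- subdivision of ∂ σ; the first argument bounds the depth of this recursion,
-- and the value is correct as soon as it is at least |σ|.
sd : ∀ {n} → ℕ → Subset n → Λ (2 ℕ.^ n)
sd j σ with ∅-or-nonempty σ
sd j       σ | inj₁ _ = basis ∅
sd zero    σ | inj₂ _ = 𝟎
sd (suc j) σ | inj₂ _ = fromSub σ ∧ extend (sd j) (∂ (basis σ))

-- Depth `n` always suffices, as a subset of `Fin n` has at most `n` elements.
Sd : ∀ {n} → Λ n → Λ (2 ℕ.^ n)
Sd {n} = extend (sd n)

sd-∅ : ∀ {n} j → sd j (∅ {n}) ≡ basis ∅
sd-∅ {n} j with ∅-or-nonempty (∅ {n})
... | inj₁ _       = refl
... | inj₂ (v , p) = ⊥-elim (∉⊥ p)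

sd-zero : ∀ {n} {σ : Subset n} → Nonempty σ → sd 0 σ ≡ 𝟎
sd-zero {σ = σ} (v , p) with ∅-or-nonempty σ
... | inj₁ refl = ⊥-elim (∉⊥ p)
... | inj₂ _    = refl

sd-suc : ∀ {n} j {σ : Subset n} → Nonempty σ →
  sd (suc j) σ ≡ fromSub σ ∧ extend (sd j) (∂ (basis σ))
sd-suc j {σ} (v , p) with ∅-or-nonempty σ
... | inj₁ refl = ⊥-elim (∉⊥ p)
... | inj₂ _    = refl

nonempty-card : ∀ {n} {σ : Subset n} → Nonempty σ → ¬ (∣ σ ∣ ≤ 0)
nonempty-card {σ = true ∷ σ}  _                 ()
nonempty-card {σ = false ∷ σ} (suc v , there p) c = nonempty-card (v , p) c

∂-card : ∀ {n j} (σ : Subset n) → ∣ σ ∣ ≤ suc j → Span (λ τ → ∣ τ ∣ ≤ j) (∂ (basis σ))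
∂-card σ c = Span-mono (λ (_ , e) → ℕ.s≤s⁻¹ (ℕ.≤-trans (ℕ.≤-reflexive e) c)) (∂-basis-Span σ)

-- Unfolding `sd (suc j)` exposes `sd j` on the boundary, while the chain map identity has the same
-- depth on both sides. Stability beyond the cardinality bridges the two.
sd-stable : ∀ {n} j (σ : Subset n) → ∣ σ ∣ ≤ j → sd j σ ≡ sd (suc j) σ
extend-sd-stable : ∀ {n} j {x : Λ n} → Span (λ τ → ∣ τ ∣ ≤ j) x →
  extend (sd j) x ≡ extend (sd (suc j)) x

sd-stable j σ c with ∅-or-nonempty σ
sd-stable j       σ c | inj₁ _  = refl
sd-stable zero    σ c | inj₂ ne = ⊥-elim (nonempty-card ne c)
sd-stable (suc j) σ c | inj₂ _  = cong (fromSub σ ∧_) (extend-sd-stable j (∂-card σ c))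

extend-sd-stable j = agree-on-Span (extend-linear _) (extend-linear _)
  (λ {σ} c → trans (extend-basis (sd j) σ)
    (trans (sd-stable j σ c) (sym (extend-basis (sd (suc j)) σ))))

-- By induction the subdivision `y` of the boundary satisfies ∂y = `extend (sd j)` (∂∂σ) = 𝟎. The
-- boundary of a cone over a cycle is that cycle.
∂-sd : ∀ {n} j (σ : Subset n) → ∣ σ ∣ ≤ j → ∂ (sd j σ) ≡ extend (sd j) (∂ (basis σ))
∂-sd {n} j σ c with ∅-or-nonempty σ
∂-sd {n} j σ c | inj₁ refl =
  trans ∂-∅ (sym (trans (cong (extend (sd {n} j)) ∂-∅) (𝟎-homo (extend-linear (sd {n} j)))))
∂-sd {n} zero    σ c | inj₂ ne = ⊥-elim (nonempty-card ne c)
∂-sd {n} (suc j) σ c | inj₂ ne = begin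
  ∂ (v ∧ y)
    ≡⟨ ∂-∧′ v y ⟩
  y ⊕ neg (v ∧ ∂ y)
    ≡⟨ cong (λ z → y ⊕ neg (v ∧ z)) ∂y≡𝟎 ⟩
  y ⊕ neg (v ∧ 𝟎)
    ≡⟨ cong (y ⊕_) (trans (cong neg (𝟎-homo (∧-linear v))) (·-𝟎 -1ℤ)) ⟩
  y ⊕ 𝟎
    ≡⟨ ⊕-identityʳ y ⟩
  y
    ≡⟨ extend-sd-stable j (∂-card σ c) ⟩
  extend (sd (suc j)) (∂ (basis σ)) ∎
  where
    v = fromSub σ
    y = extend (sd j) (∂ (basis σ))
    ∂y≡𝟎 : ∂ y ≡ 𝟎
    ∂y≡𝟎 = begin
      ∂ (extend (sd j) (∂ (basis σ)))
        ≡⟨ agree-on-Span (∘-linear ∂-linear (extend-linear (sd j)))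
             (∘-linear (extend-linear (sd j)) ∂-linear)
             (λ {τ} c′ → trans (cong ∂ (extend-basis (sd j) τ)) (∂-sd j τ c′)) (∂-card σ c) ⟩
      extend (sd j) (∂ (∂ (basis σ)))
        ≡⟨ cong (extend (sd j)) (∂∂≡𝟎 (basis σ)) ⟩
      extend (sd {n} j) 𝟎
        ≡⟨ 𝟎-homo (extend-linear (sd {n} j)) ⟩
      𝟎 ∎

∂-Sd : ∀ {n} (x : Λ n) → ∂ (Sd x) ≡ Sd (∂ x)
∂-Sd {n} = agree-everywhere (∘-linear ∂-linear (extend-linear (sd n)))
  (∘-linear (extend-linear (sd n)) ∂-linear)
  (λ σ → trans (cong ∂ (extend-basis (sd n) σ)) (∂-sd n σ (∣p∣≤n σ)))

-- `BdMap g` takes the barycentre of `σ` to that of `img g σ`, and pushforward commutes with ∂, so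
-- the recursion is natural at every depth. If `g` collapses `σ`, the scalar `s` is 0 and both sides
-- vanish. Nonemptiness must pass to the image because `sd` treats the empty simplex separately.
push-sd : ∀ {n} (g : Fin n → Fin n) j (σ : Subset n) →
  push (BdMap g) (sd j σ) ≡ extend (sd j) (push g (basis σ))
push-sd {n} g j σ with ∅-or-nonempty σ
push-sd {n} g j σ | inj₁ refl = begin
  push (BdMap g) (basis ∅)          ≡⟨ push-∅ (BdMap g) ⟩
  basis ∅                           ≡⟨ sym (sd-∅ {n} j) ⟩
  sd {n} j ∅                          ≡⟨ sym (extend-basis (sd {n} j) ∅) ⟩
  extend (sd {n} j) (basis ∅)         ≡⟨ cong (extend (sd j)) (sym (push-∅ g)) ⟩
  extend (sd {n} j) (push g (basis ∅)) ∎
push-sd {n} g zero σ | inj₂ ne with push-basis g σ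
... | s , e = begin
  push (BdMap g) 𝟎                  ≡⟨ 𝟎-homo (push-linear (BdMap g)) ⟩
  𝟎                                 ≡⟨ sym (·-𝟎 s) ⟩
  s · 𝟎                             ≡⟨ cong (s ·_) (sym (sd-zero (img-nonempty g ne))) ⟩
  s · sd 0 (img g σ)                ≡⟨ cong (s ·_) (sym (extend-basis (sd 0) (img g σ))) ⟩
  s · extend (sd 0) (basis (img g σ))
    ≡⟨ sym (·-homo (extend-linear (sd 0)) s (basis (img g σ))) ⟩
  extend (sd 0) (s · basis (img g σ))
    ≡⟨ cong (extend (sd 0)) (sym e) ⟩
  extend (sd 0) (push g (basis σ))  ∎
push-sd {n} g (suc j) σ | inj₂ ne with push-basis g σ
... | s , e = begin
  push (BdMap g) (fromSub σ ∧ extend (sd j) (∂ (basis σ)))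
    ≡⟨ push-∧ (BdMap g) (fromSub σ) _ ⟩
  BdMap g (fromSub σ) ∧ push (BdMap g) (extend (sd j) (∂ (basis σ)))
    ≡⟨ cong₂ _∧_ (cong (fromSub ∘ img g) (toSub-fromSub σ))
         (agree-everywhere (∘-linear (push-linear (BdMap g)) (extend-linear (sd j)))
           (∘-linear (extend-linear (sd j)) (push-linear g))
           (λ τ → trans (cong (push (BdMap g)) (extend-basis (sd j) τ)) (push-sd g j τ))
           (∂ (basis σ))) ⟩
  w ∧ extend (sd j) (push g (∂ (basis σ)))
    ≡⟨ cong (λ z → w ∧ extend (sd j) z) (trans (sym (∂-push g (basis σ))) (cong ∂ e)) ⟩
  w ∧ extend (sd j) (∂ (s · basis (img g σ)))
    ≡⟨ ·-homo (∘-linear (∧-linear w) (∘-linear (extend-linear (sd j)) ∂-linear)) s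
         (basis (img g σ)) ⟩
  s · w ∧ extend (sd j) (∂ (basis (img g σ)))
    ≡⟨ cong (s ·_) (sym (sd-suc j (img-nonempty g ne))) ⟩
  s · sd (suc j) (img g σ)
    ≡⟨ cong (s ·_) (sym (extend-basis (sd (suc j)) (img g σ))) ⟩
  s · extend (sd (suc j)) (basis (img g σ))
    ≡⟨ sym (·-homo (extend-linear (sd (suc j))) s (basis (img g σ))) ⟩
  extend (sd (suc j)) (s · basis (img g σ))
    ≡⟨ cong (extend (sd (suc j))) (sym e) ⟩
  extend (sd (suc j)) (push g (basis σ)) ∎
  where w = fromSub (img g σ)

push-Sd : ∀ {n} (g : Fin n → Fin n) (x : Λ n) → push (BdMap g) (Sd x) ≡ Sd (push g x)
push-Sd {n} g = agree-everywhere (∘-linear (push-linear (BdMap g)) (extend-linear (sd n)))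
  (∘-linear (extend-linear (sd n)) (push-linear g))
  (λ σ → trans (cong (push (BdMap g)) (extend-basis (sd n) σ)) (push-sd g n σ))

-- Supports of subdivided chains

module _ (K : Complex) (closed : IsSimplicialComplex K) where

  -- The carrier of `σ`: simplices of the subdivision whose vertices are faces of `σ`. Membership in
  -- `Bd K` alone would be too weak for the induction, since the barycentre of `σ` can be added to a
  -- chain of faces only if all of them lie below `σ`.
  SubdividedIn : Subset (n K) → Subset (2 ℕ.^ n K) → Set
  SubdividedIn σ S = IsSimplex (Bd K) S × (∀ i → i ∈ S → toSub (n K) i ⊆ σ)

  ∅-subdividedIn : ∀ {σ} → SubdividedIn σ ∅
  ∅-subdividedIn = (λ i p → ⊥-elim (∉⊥ p)) , (λ i p → ⊥-elim (∉⊥ p))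

  add-barycentre : ∀ {σ S} → IsSimplex K σ → Nonempty σ → SubdividedIn σ S →
    SubdividedIn σ (⁅ fromSub σ ⁆ ∪ S)
  add-barycentre {σ} {S} s ne (S∈Bd , S⊆σ) = simplex , λ i p → below (cases p)
    where
      Vertex : Fin (2 ℕ.^ n K) → Set
      Vertex i = toSub (n K) i ≡ σ ⊎ i ∈ S

      cases : ∀ {i} → i ∈ ⁅ fromSub σ ⁆ ∪ S → Vertex i
      cases p with x∈p∪q⁻ ⁅ fromSub σ ⁆ S p
      ... | inj₁ q rewrite x∈⁅y⁆⇒x≡y (fromSub σ) q = inj₁ (toSub-fromSub σ)
      ... | inj₂ q = inj₂ q

      below : ∀ {i} → Vertex i → toSub (n K) i ⊆ σ
      below (inj₁ refl) = ⊆-refl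
      below (inj₂ q)    = S⊆σ _ q

      isVertex : ∀ {i} → Vertex i → Nonempty (toSub (n K) i) × IsSimplex K (toSub (n K) i)
      isVertex (inj₁ refl) = ne , s
      isVertex (inj₂ q)    = proj₁ (S∈Bd _ q)

      comparable : ∀ {i j} → Vertex i → Vertex j →
        toSub (n K) i ⊆ toSub (n K) j ⊎ toSub (n K) j ⊆ toSub (n K) i
      comparable (inj₁ refl) q           = inj₂ (below q)
      comparable (inj₂ p)    (inj₁ refl) = inj₁ (S⊆σ _ p)
      comparable (inj₂ p)    (inj₂ q)    = proj₂ (S∈Bd _ p) _ q

      simplex : IsSimplex (Bd K) (⁅ fromSub σ ⁆ ∪ S)
      simplex i p = isVertex (cases p) , λ j q → comparable (cases p) (cases q)

  sd-Span : ∀ j {σ} → IsSimplex K σ → Span (SubdividedIn σ) (sd j σ)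
  sd-Span j {σ} s with ∅-or-nonempty σ
  sd-Span j       s | inj₁ _  = s-basis ∅-subdividedIn
  sd-Span zero    s | inj₂ _  = s-𝟎
  sd-Span (suc j) {σ} s | inj₂ ne =
    Span-map (∧-linear (fromSub σ)) (λ q → ∧-basis-Span (fromSub σ) (add-barycentre s ne q))
      (Span-map (extend-linear (sd j)) step (∂-basis-Span σ))
    where
      step : ∀ {τ} → IsFacet τ σ → Span (SubdividedIn σ) (extend (sd j) (basis τ))
      step {τ} (τ⊆σ , _) = subst (Span _) (sym (extend-basis (sd j) τ))
        (Span-mono (λ (a , b) → a , λ i p → ⊆-trans (b i p) τ⊆σ)
          (sd-Span j (proj₂ closed τ⊆σ s)))

  Sd-Span : ∀ {x} → Span (IsSimplex K) x → Span (IsSimplex (Bd K)) (Sd x)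
  Sd-Span = Span-map (extend-linear (sd (n K)))
    (λ {σ} s → subst (Span _) (sym (extend-basis (sd (n K)) σ))
      (Span-mono proj₁ (sd-Span (n K) s)))

  Bd-closed : IsSimplicialComplex (Bd K)
  Bd-closed = (λ i p → ⊥-elim (∉⊥ p)) ,
    λ τ⊆σ s i p → proj₁ (s i (τ⊆σ p)) , λ j q → proj₂ (s i (τ⊆σ p)) j (τ⊆σ q)

-- Finite sums

∑ : ∀ {A : Set} → List A → (A → ℤ) → ℤ
∑ []       f = 0ℤ
∑ (x ∷ xs) f = f x + ∑ xs f

∑-cong : ∀ {A : Set} xs {f g : A → ℤ} → (∀ {x} → x ∈ₗ xs → f x ≡ g x) → ∑ xs f ≡ ∑ xs g
∑-cong []       e = refl
∑-cong (x ∷ xs) e = cong₂ _+_ (e (here refl)) (∑-cong xs (e ∘ there))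

∑-zero : ∀ {A : Set} (xs : List A) → ∑ xs (λ _ → 0ℤ) ≡ 0ℤ
∑-zero []       = refl
∑-zero (x ∷ xs) = trans (ℤ.+-identityˡ _) (∑-zero xs)

+-medial : ∀ a b c d → (a + b) + (c + d) ≡ (a + c) + (b + d)
+-medial a b c d = begin
  (a + b) + (c + d)  ≡⟨ ℤ.+-assoc a b (c + d) ⟩
  a + (b + (c + d))  ≡⟨ cong (a +_) (sym (ℤ.+-assoc b c d)) ⟩
  a + ((b + c) + d)  ≡⟨ cong (λ z → a + (z + d)) (ℤ.+-comm b c) ⟩
  a + ((c + b) + d)  ≡⟨ cong (a +_) (ℤ.+-assoc c b d) ⟩
  a + (c + (b + d))  ≡⟨ sym (ℤ.+-assoc a c (b + d)) ⟩
  (a + c) + (b + d)  ∎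

∑-+ : ∀ {A : Set} xs (f g : A → ℤ) → ∑ xs (λ x → f x + g x) ≡ ∑ xs f + ∑ xs g
∑-+ []       f g = refl
∑-+ (x ∷ xs) f g = trans (cong (f x + g x +_) (∑-+ xs f g)) (+-medial (f x) (g x) _ _)

∑-* : ∀ {A : Set} xs c (f : A → ℤ) → ∑ xs (λ x → c * f x) ≡ c * ∑ xs f
∑-* []       c f = sym (ℤ.*-zeroʳ c)
∑-* (x ∷ xs) c f =
  trans (cong (c * f x +_) (∑-* xs c f)) (sym (ℤ.*-distribˡ-+ c (f x) (∑ xs f)))

∑-swap : ∀ {A B : Set} xs ys (f : A → B → ℤ) →
  ∑ xs (λ x → ∑ ys (f x)) ≡ ∑ ys (λ y → ∑ xs (λ x → f x y))
∑-swap []       ys f = sym (∑-zero ys)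
∑-swap (x ∷ xs) ys f =
  trans (cong (∑ ys (f x) +_) (∑-swap xs ys f)) (sym (∑-+ ys (f x) _))

∑-++ : ∀ {A : Set} xs ys (f : A → ℤ) → ∑ (xs ++ ys) f ≡ ∑ xs f + ∑ ys f
∑-++ []       ys f = sym (ℤ.+-identityˡ _)
∑-++ (x ∷ xs) ys f = trans (cong (f x +_) (∑-++ xs ys f)) (sym (ℤ.+-assoc (f x) _ _))

∑-↭ : ∀ {A : Set} {xs ys : List A} (f : A → ℤ) → xs ↭ ys → ∑ xs f ≡ ∑ ys f
∑-↭ f ↭.refl          = refl
∑-↭ f (↭.prep x p)    = cong (f x +_) (∑-↭ f p)
∑-↭ f (↭.trans p q)   = trans (∑-↭ f p) (∑-↭ f q)
∑-↭ {xs = _ ∷ _ ∷ xs} {ys = _ ∷ _ ∷ ys} f (↭.swap x y p) = begin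
  f x + (f y + ∑ xs f)  ≡⟨ sym (ℤ.+-assoc (f x) (f y) _) ⟩
  f x + f y + ∑ xs f    ≡⟨ cong₂ _+_ (ℤ.+-comm (f x) (f y)) (∑-↭ f p) ⟩
  f y + f x + ∑ ys f    ≡⟨ ℤ.+-assoc (f y) (f x) _ ⟩
  f y + (f x + ∑ ys f)  ∎

∑-const : ∀ {A : Set} (h : ℕ → A) m {c} (f : A → ℤ) → (∀ i → f (h i) ≡ c) →
  ∑ (applyUpTo h m) f ≡ pos m * c
∑-const h zero    f e = refl
∑-const h (suc m) {c} f e = trans (cong₂ _+_ (e 0) (∑-const (h ∘ suc) m f (e ∘ suc)))
  (sym (ℤ.suc-* (pos m) c))

∑-delta : ∀ {n} {L : List (Subset n)} {σ} (c : Subset n → ℤ) → Unique L → σ ∈ₗ L →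
  ∑ L (λ τ → c τ * coeff (basis σ) τ) ≡ c σ
∑-delta {L = σ ∷ L} c (σ∉L ∷ u) (here refl) = begin
  c σ * coeff (basis σ) σ + ∑ L (λ τ → c τ * coeff (basis σ) τ)
    ≡⟨ cong₂ _+_ (trans (cong (c σ *_) (coeff-basis-≡ σ)) (ℤ.*-identityʳ (c σ)))
         (trans (∑-cong L (λ {τ} τ∈L →
             trans (cong (c τ *_) (coeff-basis-≢ (All.lookup σ∉L τ∈L))) (ℤ.*-zeroʳ (c τ))))
           (∑-zero L)) ⟩
  c σ + 0ℤ
    ≡⟨ ℤ.+-identityʳ (c σ) ⟩
  c σ ∎
∑-delta {L = τ ∷ L} {σ} c (τ∉L ∷ u) (there p) = begin
  c τ * coeff (basis σ) τ + ∑ L (λ τ → c τ * coeff (basis σ) τ)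
    ≡⟨ cong₂ _+_
         (trans (cong (c τ *_) (coeff-basis-≢ (All.lookup τ∉L p ∘ sym))) (ℤ.*-zeroʳ (c τ)))
         (∑-delta c u p) ⟩
  0ℤ + c σ
    ≡⟨ ℤ.+-identityˡ (c σ) ⟩
  c σ ∎

-- Traces

⟨⟩-injective : ∀ {c d} → ⟨ c ⟩ ≡ ⟨ d ⟩ → c ≡ d
⟨⟩-injective refl = refl

-- Wrapping a coefficient in `⟨_⟩` turns the functional into a linear map to `Λ 0`, so that the
-- agreement principles for linear maps also prove identities between integers.
coeff-linear : ∀ {n} (σ : Subset n) → Linear (λ x → ⟨ coeff x σ ⟩)
coeff-linear σ = record
  { ⊕-homo = λ x y → cong ⟨_⟩ (coeff-⊕ x y σ)
  ; ·-homo = λ c x → cong ⟨_⟩ (coeff-· c x σ) }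

∑-coeff-linear : ∀ {n} (L : List (Subset n)) (c : Subset n → ℤ) →
  Linear (λ x → ⟨ ∑ L (λ τ → c τ * coeff x τ) ⟩)
∑-coeff-linear []      c = 𝟎-linear
∑-coeff-linear (τ ∷ L) c =
  ⊕-linear (∘-linear (·-linear (c τ)) (coeff-linear τ)) (∑-coeff-linear L c)

coeff-expand : ∀ {m n} {L : List (Subset m)} → Unique L → ∀ {F : Λ m → Λ n} → Linear F →
  ∀ ρ {x} → Span (_∈ₗ L) x → coeff (F x) ρ ≡ ∑ L (λ τ → coeff (F (basis τ)) ρ * coeff x τ)
coeff-expand {L = L} u {F} LF ρ s = ⟨⟩-injective
  (agree-on-Span (∘-linear (coeff-linear ρ) LF) (∑-coeff-linear L (λ τ → coeff (F (basis τ)) ρ))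
    (λ p → cong ⟨_⟩ (sym (∑-delta (λ τ → coeff (F (basis τ)) ρ) u p))) s)

trace : ∀ {n} → List (Subset n) → (Λ n → Λ n) → ℤ
trace L F = ∑ L (λ σ → coeff (F (basis σ)) σ)

-- Both traces are the double sum of the products F(σ,τ) G(τ,σ) over `L`. Preservation of the span
-- is what makes the expansion of the intermediate chains over `L` complete.
trace-comm : ∀ {n} {L : List (Subset n)} → Unique L → ∀ {F G : Λ n → Λ n} →
  Linear F → Linear G →
  (∀ {x} → Span (_∈ₗ L) x → Span (_∈ₗ L) (F x)) →
  (∀ {x} → Span (_∈ₗ L) x → Span (_∈ₗ L) (G x)) →
  trace L (F ∘ G) ≡ trace L (G ∘ F)
trace-comm {L = L} u {F} {G} LF LG SF SG = begin
  ∑ L (λ σ → coeff (F (G (basis σ))) σ)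
    ≡⟨ ∑-cong L (λ p → coeff-expand u LF _ (SG (s-basis p))) ⟩
  ∑ L (λ σ → ∑ L (λ τ → coeff (F (basis τ)) σ * coeff (G (basis σ)) τ))
    ≡⟨ ∑-swap L L _ ⟩
  ∑ L (λ τ → ∑ L (λ σ → coeff (F (basis τ)) σ * coeff (G (basis σ)) τ))
    ≡⟨ ∑-cong L (λ {τ} _ → ∑-cong L (λ {σ} _ →
         ℤ.*-comm (coeff (F (basis τ)) σ) (coeff (G (basis σ)) τ))) ⟩
  ∑ L (λ τ → ∑ L (λ σ → coeff (G (basis σ)) τ * coeff (F (basis τ)) σ))
    ≡⟨ ∑-cong L (λ p → sym (coeff-expand u LG _ (SF (s-basis p)))) ⟩
  ∑ L (λ σ → coeff (G (F (basis σ))) σ) ∎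

ε-basis-Span : ∀ {n} (σ : Subset n) → Span (_≡ σ) (ε (basis σ))
ε-basis-Span [] = s-basis refl
ε-basis-Span (false ∷ σ) = subst (Span _)
  (cong (ε (basis σ) ﹐_) (sym (trans (cong neg (𝟎-homo ε-linear)) (·-𝟎 -1ℤ))))
  (Span-map inl-linear (λ { refl → s-basis refl }) (ε-basis-Span σ))
ε-basis-Span (true ∷ σ) = subst (Span _)
  (cong (_﹐ neg (ε (basis σ))) (trans (·-𝟎 -1ℤ) (sym (𝟎-homo ε-linear))))
  (s-· -1ℤ (Span-map inr-linear (λ { refl → s-basis refl }) (ε-basis-Span σ)))

ε-Span : ∀ {n} {P : Subset n → Set} {x} → Span P x → Span P (ε x)
ε-Span = Span-map ε-linear (λ {σ} p → Span-mono (λ { refl → p }) (ε-basis-Span σ))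

∂-Span : ∀ {n} {P : Subset n → Set} → (∀ {σ τ} → τ ⊆ σ → P σ → P τ) →
  ∀ {x} → Span P x → Span P (∂ x)
∂-Span closed = Span-map ∂-linear (λ {σ} p → Span-mono (λ (τ⊆σ , _) → closed τ⊆σ p) (∂-basis-Span σ))

-- ε anticommutes with ∂, so tr(h ∂ ε) = − tr(h ε ∂) = − tr(∂ h ε).
supertrace-nullhomotopic : ∀ {n} {L : List (Subset n)} → Unique L →
  (∀ {σ τ} → τ ⊆ σ → σ ∈ₗ L → τ ∈ₗ L) → ∀ {φ h : Λ n → Λ n} → Linear h →
  (∀ {x} → Span (_∈ₗ L) x → Span (_∈ₗ L) (h x)) →
  (∀ x → φ x ≡ ∂ (h x) ⊕ h (∂ x)) → trace L (φ ∘ ε) ≡ 0ℤ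
supertrace-nullhomotopic {L = L} u closed {φ} {h} Lh Sh e = begin
  trace L (φ ∘ ε)
    ≡⟨ ∑-cong L (λ {σ} _ → pointwise σ) ⟩
  ∑ L (λ σ → coeff (∂ (h (ε (basis σ)))) σ + -1ℤ * coeff (h (ε (∂ (basis σ)))) σ)
    ≡⟨ ∑-+ L _ _ ⟩
  trace L (∂ ∘ hε) + ∑ L (λ σ → -1ℤ * coeff (h (ε (∂ (basis σ)))) σ)
    ≡⟨ cong (trace L (∂ ∘ hε) +_) (∑-* L -1ℤ _) ⟩
  trace L (∂ ∘ hε) + -1ℤ * trace L (hε ∘ ∂)
    ≡⟨ cong₂ _+_ (trace-comm u ∂-linear (∘-linear Lh ε-linear) (∂-Span closed) (Sh ∘ ε-Span))
         (ℤ.-1*i≡-i _) ⟩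
  trace L (hε ∘ ∂) + - trace L (hε ∘ ∂)
    ≡⟨ ℤ.+-inverseʳ (trace L (hε ∘ ∂)) ⟩
  0ℤ ∎
  where
    hε = h ∘ ε
    pointwise : ∀ σ → coeff (φ (ε (basis σ))) σ ≡
      coeff (∂ (h (ε (basis σ)))) σ + -1ℤ * coeff (h (ε (∂ (basis σ)))) σ
    pointwise σ = begin
      coeff (φ (ε b)) σ
        ≡⟨ cong (λ z → coeff z σ) (e (ε b)) ⟩
      coeff (∂ (h (ε b)) ⊕ h (∂ (ε b))) σ
        ≡⟨ cong (λ z → coeff (∂ (h (ε b)) ⊕ h z) σ)
             (trans (sym (neg-neg _)) (cong neg (sym (ε-∂ b)))) ⟩
      coeff (∂ (h (ε b)) ⊕ h (neg (ε (∂ b)))) σ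
        ≡⟨ cong (λ z → coeff (∂ (h (ε b)) ⊕ z) σ) (neg-homo Lh (ε (∂ b))) ⟩
      coeff (∂ (h (ε b)) ⊕ neg (h (ε (∂ b)))) σ
        ≡⟨ coeff-⊕ (∂ (h (ε b))) (neg (h (ε (∂ b)))) σ ⟩
      coeff (∂ (h (ε b))) σ + coeff (neg (h (ε (∂ b)))) σ
        ≡⟨ cong (coeff (∂ (h (ε b))) σ +_) (coeff-· -1ℤ (h (ε (∂ b))) σ) ⟩
      coeff (∂ (h (ε b))) σ + -1ℤ * coeff (h (ε (∂ b))) σ ∎
      where b = basis σ

-- g only permutes the basis up to sign, and the two signs entering a diagonal
-- coefficient cancel.
diagonal-invariant : ∀ {n} {g g⁻¹ : Fin n → Fin n} → (∀ v → g⁻¹ (g v) ≡ v) →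
  ∀ {ψ : Λ n → Λ n} → Linear ψ → ∀ σ →
  ψ (push g (basis σ)) ≡ push g (ψ (basis σ)) →
  coeff (ψ (basis (img g σ))) (img g σ) ≡ coeff (ψ (basis σ)) σ
diagonal-invariant {n} {g} {g⁻¹} inv {ψ} Lψ σ comm =
  ℤ.*-cancelˡ-≡ s _ _ {{≢-nonZero s≢0}} (begin
    s * coeff (ψ (basis gσ)) gσ   ≡⟨ sym (coeff-· s (ψ (basis gσ)) gσ) ⟩
    coeff (s · ψ (basis gσ)) gσ     ≡⟨ cong (λ z → coeff z gσ) (sym (·-homo Lψ s (basis gσ))) ⟩
    coeff (ψ (s · basis gσ)) gσ     ≡⟨ cong (λ z → coeff (ψ z) gσ) (sym e) ⟩
    coeff (ψ (push g (basis σ))) gσ ≡⟨ cong (λ z → coeff z gσ) comm ⟩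
    coeff (push g (ψ (basis σ))) gσ ≡⟨ ⟨⟩-injective (agree-everywhere
      (∘-linear (coeff-linear gσ) (push-linear g))
      (∘-linear (·-linear s) (coeff-linear σ)) coefficient (ψ (basis σ))) ⟩
    s * coeff (ψ (basis σ)) σ     ∎)
  where
    gσ = img g σ
    s  = proj₁ (push-basis g σ)
    e  = proj₂ (push-basis g σ)

    img-injective : ∀ {τ} → img g τ ≡ gσ → τ ≡ σ
    img-injective {τ} eq = begin
      τ                  ≡⟨ sym (img-id inv τ) ⟩
      img (g⁻¹ ∘ g) τ    ≡⟨ sym (img-∘ g⁻¹ g τ) ⟩
      img g⁻¹ (img g τ)  ≡⟨ cong (img g⁻¹) eq ⟩
      img g⁻¹ gσ         ≡⟨ img-∘ g⁻¹ g σ ⟩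
      img (g⁻¹ ∘ g) σ    ≡⟨ img-id inv σ ⟩
      σ                  ∎

    -- With `s` zero, `push g` would kill `basis σ`, yet `push g⁻¹` recovers it.
    s≢0 : s ≢ 0ℤ
    s≢0 s≡0 = 1≢0 (begin
      1ℤ                                      ≡⟨ sym (coeff-basis-≡ σ) ⟩
      coeff (basis σ) σ                       ≡⟨ cong (λ z → coeff z σ) (sym (push-id (basis σ))) ⟩
      coeff (push id (basis σ)) σ             ≡⟨ cong (λ z → coeff z σ) (sym (push-cong σ (λ _ → inv _))) ⟩
      coeff (push (g⁻¹ ∘ g) (basis σ)) σ      ≡⟨ cong (λ z → coeff z σ) (sym (push-∘ g⁻¹ g (basis σ))) ⟩
      coeff (push g⁻¹ (push g (basis σ))) σ   ≡⟨ cong (λ z → coeff (push g⁻¹ z) σ)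
        (trans e (trans (cong (_· basis gσ) s≡0) (0-· (basis gσ)))) ⟩
      coeff (push g⁻¹ 𝟎) σ                    ≡⟨ cong (λ z → coeff z σ) (𝟎-homo (push-linear g⁻¹)) ⟩
      coeff 𝟎 σ                               ≡⟨ coeff-𝟎 σ ⟩
      0ℤ                                      ∎)
      where
        1≢0 : 1ℤ ≢ 0ℤ
        1≢0 ()

    -- As `g` is injective on subsets, only the `σ` term of a chain can contribute to the
    -- coefficient at `gσ`.
    coefficient : ∀ τ → ⟨ coeff (push g (basis τ)) gσ ⟩ ≡ s · ⟨ coeff (basis τ) σ ⟩
    coefficient τ with ≡-dec _≟ᵇ_ τ σ
    ... | yes refl = cong ⟨_⟩ (begin
      coeff (push g (basis σ)) gσ  ≡⟨ cong (λ z → coeff z gσ) e ⟩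
      coeff (s · basis gσ) gσ      ≡⟨ coeff-· s (basis gσ) gσ ⟩
      s * coeff (basis gσ) gσ      ≡⟨ cong (s *_) (coeff-basis-≡ gσ) ⟩
      s * 1ℤ                       ≡⟨ cong (s *_) (sym (coeff-basis-≡ σ)) ⟩
      s * coeff (basis σ) σ        ∎)
    ... | no τ≢σ with push-basis g τ
    ...   | t , e′ = cong ⟨_⟩ (begin
      coeff (push g (basis τ)) gσ  ≡⟨ cong (λ z → coeff z gσ) e′ ⟩
      coeff (t · basis (img g τ)) gσ  ≡⟨ coeff-· t (basis (img g τ)) gσ ⟩
      t * coeff (basis (img g τ)) gσ  ≡⟨ cong (t *_) (coeff-basis-≢ (τ≢σ ∘ img-injective)) ⟩
      t * 0ℤ                       ≡⟨ trans (ℤ.*-zeroʳ t) (sym (ℤ.*-zeroʳ s)) ⟩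
      s * 0ℤ                       ≡⟨ cong (s *_) (sym (coeff-basis-≢ τ≢σ)) ⟩
      s * coeff (basis τ) σ        ∎)

-- Free orbits

module _ {A : Set} (_≟_ : DecidableEquality A) (q : ℕ) (act : ℕ → A → A)
  (act-0 : ∀ x → act 0 x ≡ x) (act-+ : ∀ a b x → act (a ℕ.+ b) x ≡ act a (act b x))
  (act-p : ∀ x → act (suc q) x ≡ x) where

  private
    orbit : A → List A
    orbit x = applyUpTo (λ i → act i x) (suc q)

  act-inverse : ∀ {i} → i ≤ suc q → ∀ x → act (suc q ℕ.∸ i) (act i x) ≡ x
  act-inverse {i} i≤p x = trans (sym (act-+ (suc q ℕ.∸ i) i x))
    (trans (cong (λ m → act m x) (ℕ.m∸n+n≡m i≤p)) (act-p x))

  act-q-1 : ∀ x → act q (act 1 x) ≡ x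
  act-q-1 = act-inverse (s≤s z≤n)

  FreeAt : A → Set
  FreeAt x = ∀ g → 0 ℕ.< g → g ℕ.< suc q → act g x ≢ x

  -- A coincidence of the i-th and j-th translates would make `x` a fixed point of j - i. The
  -- rearrangement p + (j - i) = (p - i) + j undoes the i-th translate without leaving the natural
  -- numbers.
  orbit-unique : ∀ {x} → FreeAt x → Unique (orbit x)
  orbit-unique {x} free = Unique.applyUpTo⁺₁ _ (suc q) distinct
    where
      distinct : ∀ {i j} → i ℕ.< j → j ℕ.< suc q → act i x ≢ act j x
      distinct {i} {j} i<j j<p eq =
        free (j ℕ.∸ i) (ℕ.m<n⇒0<n∸m i<j) (ℕ.≤-<-trans (ℕ.m∸n≤m j i) j<p) (begin
          act (j ℕ.∸ i) x                          ≡⟨ sym (act-p _) ⟩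
          act (suc q) (act (j ℕ.∸ i) x)            ≡⟨ sym (act-+ (suc q) (j ℕ.∸ i) x) ⟩
          act (suc q ℕ.+ (j ℕ.∸ i)) x              ≡⟨ cong (λ m → act m x) shift ⟩
          act ((suc q ℕ.∸ i) ℕ.+ j) x              ≡⟨ act-+ (suc q ℕ.∸ i) j x ⟩
          act (suc q ℕ.∸ i) (act j x)              ≡⟨ cong (act (suc q ℕ.∸ i)) (sym eq) ⟩
          act (suc q ℕ.∸ i) (act i x)              ≡⟨ act-inverse i≤p x ⟩
          x                                        ∎)
        where
          i≤p : i ≤ suc q
          i≤p = ℕ.<⇒≤ (ℕ.<-trans i<j j<p)
          shift : suc q ℕ.+ (j ℕ.∸ i) ≡ (suc q ℕ.∸ i) ℕ.+ j
          shift = begin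
            suc q ℕ.+ (j ℕ.∸ i)                 ≡⟨ cong (ℕ._+ (j ℕ.∸ i)) (sym (ℕ.m∸n+n≡m i≤p)) ⟩
            (suc q ℕ.∸ i) ℕ.+ i ℕ.+ (j ℕ.∸ i)   ≡⟨ ℕ.+-assoc (suc q ℕ.∸ i) i (j ℕ.∸ i) ⟩
            (suc q ℕ.∸ i) ℕ.+ (i ℕ.+ (j ℕ.∸ i)) ≡⟨ cong ((suc q ℕ.∸ i) ℕ.+_) (ℕ.m+[n∸m]≡n (ℕ.<⇒≤ i<j)) ⟩
            (suc q ℕ.∸ i) ℕ.+ j                 ∎

  -- Used contrapositively: the complement of an orbit is stable under the generator, so a whole
  -- orbit can be removed from an invariant list.
  orbit-step⁻¹ : ∀ {x y} → act 1 y ∈ₗ orbit x → y ∈ₗ orbit x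
  orbit-step⁻¹ {x} {y} p with ∈-applyUpTo⁻ (λ i → act i x) p
  -- Wrap-around: if the generator takes `y` to `x`, then `y` is the last orbit element, the `q`-th
  -- translate.
  ... | zero , _ , e = subst (_∈ₗ orbit x)
    (trans (cong (act q) (trans (sym (act-0 x)) (sym e))) (act-q-1 y))
    (∈-applyUpTo⁺ (λ i → act i x) ℕ.≤-refl)
  ... | suc j , j<p , e = subst (_∈ₗ orbit x)
    (begin
      act j x                  ≡⟨ sym (act-q-1 _) ⟩
      act q (act 1 (act j x))  ≡⟨ cong (act q) (sym (act-+ 1 j x)) ⟩
      act q (act (suc j) x)    ≡⟨ cong (act q) (sym e) ⟩
      act q (act 1 y)          ≡⟨ act-q-1 y ⟩
      y                        ∎)
    (∈-applyUpTo⁺ (λ i → act i x) (ℕ.<⇒≤ j<p))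

  iterate-closed : ∀ {P : A → Set} → (∀ {x} → P x → P (act 1 x)) → ∀ {x} → P x → ∀ i → P (act i x)
  iterate-closed {P} closed {x} p zero    = subst P (sym (act-0 x)) p
  iterate-closed {P} closed {x} p (suc i) = subst P (sym (act-+ 1 i x)) (closed (iterate-closed {P} closed p i))

  private
    -- Split off the orbit of the head, which contributes p times one value, and recurse on what is
    -- left. That list is not a structural sublist, so `m` bounds its length to drive the recursion.
    ∑-multiple′ : ∀ m L → length L ≤ m → Unique L → (∀ {x} → x ∈ₗ L → act 1 x ∈ₗ L) →
      (∀ {x} → x ∈ₗ L → FreeAt x) → (a : A → ℤ) → (∀ {x} → x ∈ₗ L → a (act 1 x) ≡ a x) →
      ∃ λ k → ∑ L a ≡ pos (suc q) * k
    ∑-multiple′ m [] _ _ _ _ a _ = 0ℤ , sym (ℤ.*-zeroʳ (pos (suc q)))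
    ∑-multiple′ (suc m) L@(x ∷ L′) (s≤s len) u closed free a inv = a x + k , (begin
      ∑ L a                                ≡⟨ ∑-↭ a L↭ ⟩
      ∑ (orbit x ++ rest) a                ≡⟨ ∑-++ (orbit x) rest a ⟩
      ∑ (orbit x) a + ∑ rest a             ≡⟨ cong₂ _+_ (∑-const (λ i → act i x) (suc q) a constant)
                                                (proj₂ ∑-rest) ⟩
      pos (suc q) * a x + pos (suc q) * k  ≡⟨ sym (ℤ.*-distribˡ-+ (pos (suc q)) (a x) k) ⟩
      pos (suc q) * (a x + k)              ∎)
      where
        out? : ∀ y → Dec (y ∉ₗ orbit x)
        out? y = ¬? (any? (y ≟_) (orbit x))
        rest : List A
        rest = filter out? L
        shorter : length rest ℕ.< length L
        -- The head itself is removed, being its own translate by 0.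
        shorter = filter-notAll out? L (here (λ out → out (here (sym (act-0 x)))))
        rest-closed : ∀ {y} → y ∈ₗ rest → act 1 y ∈ₗ rest
        rest-closed p with ∈-filter⁻ out? p
        ... | y∈L , y∉O = ∈-filter⁺ out? (closed y∈L) (y∉O ∘ orbit-step⁻¹)
        ∑-rest : ∃ λ k → ∑ rest a ≡ pos (suc q) * k
        ∑-rest = ∑-multiple′ m rest (ℕ.s≤s⁻¹ (ℕ.≤-trans shorter (s≤s len)))
          (Unique.filter⁺ out? u) rest-closed
          (free ∘ proj₁ ∘ ∈-filter⁻ out?) a (inv ∘ proj₁ ∘ ∈-filter⁻ out?)
        k : ℤ
        k = proj₁ ∑-rest
        orbit⊆L : ∀ i → act i x ∈ₗ L
        orbit⊆L = iterate-closed {P = _∈ₗ L} closed (here refl)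
        constant : ∀ i → a (act i x) ≡ a x
        constant i = proj₂ (iterate-closed {P = λ y → y ∈ₗ L × a y ≡ a x}
          (λ (p , e) → closed p , trans (inv p) e) (here refl , refl) i)
        to : ∀ {y} → y ∈ₗ L → y ∈ₗ orbit x ++ rest
        to {y} p with any? (y ≟_) (orbit x)
        ... | yes y∈O = ∈-++⁺ˡ y∈O
        ... | no  y∉O = ∈-++⁺ʳ (orbit x) (∈-filter⁺ out? p y∉O)
        from : ∀ {y} → y ∈ₗ orbit x ++ rest → y ∈ₗ L
        from p with ∈-++⁻ (orbit x) p
        ... | inj₂ r = proj₁ (∈-filter⁻ out? r)
        ... | inj₁ r with ∈-applyUpTo⁻ (λ i → act i x) r
        ...   | i , _ , refl = orbit⊆L i
        L↭ : L ↭ orbit x ++ rest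
        -- Duplicate-free lists with the same members are permutations of one another; the orbit and
        -- `rest` are disjoint by the choice of the filter.
        L↭ = ∼bag⇒↭ (unique∧set⇒bag u
          (Unique.++⁺ (orbit-unique (free (here refl))) (Unique.filter⁺ out? u)
            (λ (p , r) → proj₂ (∈-filter⁻ out? {xs = L} r) p))
          (mk⇔ to from))

  ∑-multiple : ∀ L → Unique L → (∀ {x} → x ∈ₗ L → act 1 x ∈ₗ L) →
    (∀ {x} → x ∈ₗ L → FreeAt x) → (a : A → ℤ) → (∀ {x} → x ∈ₗ L → a (act 1 x) ≡ a x) →
    ∃ λ k → ∑ L a ≡ pos (suc q) * k
  ∑-multiple L = ∑-multiple′ (length L) L ℕ.≤-refl

-- Joins

↑-view : ∀ m {k} (v : Fin (m ℕ.+ k)) → (∃ λ i → i ↑ˡ k ≡ v) ⊎ (∃ λ j → m ↑ʳ j ≡ v)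
↑-view m v with splitAt m v in eq
... | inj₁ i = inj₁ (i , splitAt⁻¹-↑ˡ eq)
... | inj₂ j = inj₂ (j , splitAt⁻¹-↑ʳ eq)

↑ˡ≢↑ʳ : ∀ {m k} {i : Fin m} {j : Fin k} → i ↑ˡ k ≢ m ↑ʳ j
↑ˡ≢↑ʳ {m} {k} {i} {j} e
  with trans (sym (splitAt-↑ˡ m i k)) (trans (cong (splitAt m) e) (splitAt-↑ʳ m k j))
... | ()

∈-take⁺ : ∀ m {k} {σ : Subset (m ℕ.+ k)} {i} → i ↑ˡ k ∈ σ → i ∈ take m σ
∈-take⁺ (suc m) {σ = x ∷ σ} {zero}  here      = here
∈-take⁺ (suc m) {σ = x ∷ σ} {suc i} (there p) = there (∈-take⁺ m p)

∈-take⁻ : ∀ m {k} {σ : Subset (m ℕ.+ k)} {i} → i ∈ take m σ → i ↑ˡ k ∈ σ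
∈-take⁻ (suc m) {σ = x ∷ σ} here      = here
∈-take⁻ (suc m) {σ = x ∷ σ} (there p) = there (∈-take⁻ m p)

∈-drop⁺ : ∀ m {k} {σ : Subset (m ℕ.+ k)} {j} → m ↑ʳ j ∈ σ → j ∈ drop m σ
∈-drop⁺ zero    p                       = p
∈-drop⁺ (suc m) {σ = x ∷ σ} (there p) = ∈-drop⁺ m p

∈-drop⁻ : ∀ m {k} {σ : Subset (m ℕ.+ k)} {j} → j ∈ drop m σ → m ↑ʳ j ∈ σ
∈-drop⁻ zero                p = p
∈-drop⁻ (suc m) {σ = x ∷ σ} p = there (∈-drop⁻ m p)

joinMap-↑ˡ : ∀ {m k} (f : Fin m → Fin m) (g : Fin k → Fin k) i →
  joinMap f g (i ↑ˡ k) ≡ f i ↑ˡ k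
joinMap-↑ˡ {m} {k} f g i rewrite splitAt-↑ˡ m i k = refl

joinMap-↑ʳ : ∀ {m k} (f : Fin m → Fin m) (g : Fin k → Fin k) j →
  joinMap f g (m ↑ʳ j) ≡ m ↑ʳ g j
joinMap-↑ʳ {m} {k} f g j rewrite splitAt-↑ʳ m k j = refl

take-img : ∀ {m k} (f : Fin m → Fin m) (g : Fin k → Fin k) σ →
  take m (img (joinMap f g) σ) ≡ img f (take m σ)
take-img {m} {k} f g σ = ⊆-antisym to from
  where
    to : take m (img (joinMap f g) σ) ⊆ img f (take m σ)
    to p with ∈-img⁻ (joinMap f g) σ (∈-take⁻ m p)
    ... | v , q , e with ↑-view m v
    ...   | inj₁ (i , refl) = subst (_∈ img f (take m σ))
      (↑ˡ-injective k _ _ (trans (sym (joinMap-↑ˡ f g i)) e)) (∈-img⁺ f (∈-take⁺ m q))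
    ...   | inj₂ (j , refl) = ⊥-elim (↑ˡ≢↑ʳ (trans (sym e) (joinMap-↑ʳ f g j)))
    from : img f (take m σ) ⊆ take m (img (joinMap f g) σ)
    from p with ∈-img⁻ f (take m σ) p
    ... | i , q , refl = ∈-take⁺ m (subst (_∈ img (joinMap f g) σ) (joinMap-↑ˡ f g i)
      (∈-img⁺ (joinMap f g) (∈-take⁻ m q)))

drop-img : ∀ {m k} (f : Fin m → Fin m) (g : Fin k → Fin k) σ →
  drop m (img (joinMap f g) σ) ≡ img g (drop m σ)
drop-img {m} {k} f g σ = ⊆-antisym to from
  where
    to : drop m (img (joinMap f g) σ) ⊆ img g (drop m σ)
    to p with ∈-img⁻ (joinMap f g) σ (∈-drop⁻ m p)
    ... | v , q , e with ↑-view m v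
    ...   | inj₂ (j , refl) = subst (_∈ img g (drop m σ))
      (↑ʳ-injective m _ _ (trans (sym (joinMap-↑ʳ f g j)) e)) (∈-img⁺ g (∈-drop⁺ m q))
    ...   | inj₁ (i , refl) = ⊥-elim (↑ˡ≢↑ʳ (trans (sym (joinMap-↑ˡ f g i)) e))
    from : img g (drop m σ) ⊆ drop m (img (joinMap f g) σ)
    from p with ∈-img⁻ g (drop m σ) p
    ... | j , q , refl = ∈-drop⁺ m (subst (_∈ img (joinMap f g) σ) (joinMap-↑ʳ f g j)
      (∈-img⁺ (joinMap f g) (∈-drop⁻ m q)))

-- This class is stable under joins, which allows induction on the number of factors.
record FreeComplex (p : ℕ) (A : CxAct) : Set where
  field
    isComplex : IsSimplicialComplex (K A)
    isAction  : IsZpAction p (K A) (act A)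
    isFree    : IsFree p (K A) (act A)

join-isComplex : ∀ {K₁ K₂} → IsSimplicialComplex K₁ → IsSimplicialComplex K₂ →
  IsSimplicialComplex (joinCx K₁ K₂)
join-isComplex {K₁} {K₂} (∅₁ , closed₁) (∅₂ , closed₂) =
  (closed₁ (λ p → ⊥-elim (∉⊥ (∈-take⁻ m p))) ∅₁ , closed₂ (λ p → ⊥-elim (∉⊥ (∈-drop⁻ m p))) ∅₂) ,
  λ τ⊆σ (s₁ , s₂) → closed₁ (λ p → ∈-take⁺ m (τ⊆σ (∈-take⁻ m p))) s₁ ,
                    closed₂ (λ p → ∈-drop⁺ m (τ⊆σ (∈-drop⁻ m p))) s₂
  where m = n K₁

joinMap-cases : ∀ {m k} {F : Fin (m ℕ.+ k) → Fin (m ℕ.+ k)} {f : Fin m → Fin m} {g : Fin k → Fin k} →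
  (∀ i → F (i ↑ˡ k) ≡ f i ↑ˡ k) → (∀ j → F (m ↑ʳ j) ≡ m ↑ʳ g j) → ∀ v → F v ≡ joinMap f g v
joinMap-cases {m} {f = f} {g} eˡ eʳ v with ↑-view m v
... | inj₁ (i , refl) = trans (eˡ i) (sym (joinMap-↑ˡ f g i))
... | inj₂ (j , refl) = trans (eʳ j) (sym (joinMap-↑ʳ f g j))

joinMap-id : ∀ {m k} {f : Fin m → Fin m} {g : Fin k → Fin k} →
  (∀ i → f i ≡ i) → (∀ j → g j ≡ j) → ∀ v → joinMap f g v ≡ v
joinMap-id {m} {k} {f} {g} eˡ eʳ v = sym (joinMap-cases {F = id} {f} {g}
  (λ i → cong (_↑ˡ k) (sym (eˡ i))) (λ j → cong (m ↑ʳ_) (sym (eʳ j))) v)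

joinMap-∘ : ∀ {m k} {f f₁ f₂ : Fin m → Fin m} {g g₁ g₂ : Fin k → Fin k} →
  (∀ i → f i ≡ f₁ (f₂ i)) → (∀ j → g j ≡ g₁ (g₂ j)) →
  ∀ v → joinMap f g v ≡ joinMap f₁ g₁ (joinMap f₂ g₂ v)
joinMap-∘ {m} {k} {f} {f₁} {f₂} {g} {g₁} {g₂} eˡ eʳ v =
  sym (joinMap-cases {F = joinMap f₁ g₁ ∘ joinMap f₂ g₂} {f} {g}
    (λ i → trans (cong (joinMap f₁ g₁) (joinMap-↑ˡ f₂ g₂ i))
      (trans (joinMap-↑ˡ f₁ g₁ (f₂ i)) (cong (_↑ˡ k) (sym (eˡ i)))))
    (λ j → trans (cong (joinMap f₁ g₁) (joinMap-↑ʳ f₂ g₂ j))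
      (trans (joinMap-↑ʳ f₁ g₁ (g₂ j)) (cong (m ↑ʳ_) (sym (eʳ j))))) v)

-- A nonempty simplex of the join has a vertex in one of the factors. If a group element fixed the
-- simplex, it would fix its nonempty part there, against freeness of that factor.
join-free : ∀ {p A B} → FreeComplex p A → FreeComplex p B → FreeComplex p (joinCA A B)
join-free {p} {A} {B} FA FB
  with FreeComplex.isAction FA | FreeComplex.isAction FB
... | a0 , a+ , ap , a-simp | b0 , b+ , bp , b-simp = record
  { isComplex = join-isComplex (FreeComplex.isComplex FA) (FreeComplex.isComplex FB)
  ; isAction  =
      joinMap-id a0 b0 ,
      (λ g h → joinMap-∘ (a+ g h) (b+ g h)) ,
      joinMap-id ap bp ,
      λ g σ (s₁ , s₂) →
        subst (IsSimplex (K A)) (sym (take-img (act A g) (act B g) σ)) (a-simp g _ s₁) ,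
        subst (IsSimplex (K B)) (sym (drop-img (act A g) (act B g) σ)) (b-simp g _ s₂)
  ; isFree    = isFree }
  where
    m = n (K A)
    isFree : IsFree p (K (joinCA A B)) (act (joinCA A B))
    isFree g 0<g g<p σ (s₁ , s₂) (v , q) e with ↑-view m v
    ... | inj₁ (i , refl) = FreeComplex.isFree FA g 0<g g<p (take m σ) s₁ (i , ∈-take⁺ m q)
      (trans (sym (take-img (act A g) (act B g) σ)) (cong (take m) e))
    ... | inj₂ (j , refl) = FreeComplex.isFree FB g 0<g g<p (drop m σ) s₂ (j , ∈-drop⁺ m q)
      (trans (sym (drop-img (act A g) (act B g) σ)) (cong (drop m) e))

sphere-free : ∀ {p} (S : ZpSphere p) → FreeComplex p (toCxAct S)
sphere-free S = record
  { isComplex = proj₁ (proj₁ (sphere S)) ; isAction = action S ; isFree = free S }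

joinAll-free : ∀ {p} m (S : Fin (suc m) → ZpSphere p) → FreeComplex p (joinAll (suc m) S)
joinAll-free zero    S = sphere-free (S zero)
joinAll-free (suc m) S = join-free (sphere-free (S zero)) (joinAll-free m (S ∘ suc))

-- Iterated subdivision

SdIter : ∀ k {A} → Λ (n (K A)) → Λ (n (K (BdIter k A)))
SdIter zero    x = x
SdIter (suc k) x = Sd (SdIter k x)

SdIter-linear : ∀ k {A} → Linear (SdIter k {A})
SdIter-linear zero    = id-linear
SdIter-linear (suc k) {A} = ∘-linear (extend-linear (sd (n (K (BdIter k A))))) (SdIter-linear k)

SdIter-∅ : ∀ k {A} → SdIter k {A} (basis ∅) ≡ basis ∅
SdIter-∅ zero = refl
SdIter-∅ (suc k) {A} = trans (cong (Sd {N}) (SdIter-∅ k {A}))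
  (trans (extend-basis (sd {N} N) ∅) (sd-∅ {N} N))
  where N = n (K (BdIter k A))

∂-SdIter : ∀ k {A} x → ∂ (SdIter k {A} x) ≡ SdIter k {A} (∂ x)
∂-SdIter zero    x = refl
∂-SdIter (suc k) {A} x = trans (∂-Sd (SdIter k {A} x)) (cong Sd (∂-SdIter k x))

-- By definition the action on one more subdivision is `BdMap` of the action below, so naturality of
-- `Sd` iterates.
push-SdIter : ∀ k {A} g x →
  push (act (BdIter k A) g) (SdIter k {A} x) ≡ SdIter k {A} (push (act A g) x)
push-SdIter zero    g x = refl
push-SdIter (suc k) {A} g x =
  trans (push-Sd (act (BdIter k A) g) (SdIter k {A} x)) (cong Sd (push-SdIter k g x))

BdIter-isComplex : ∀ k {A} → IsSimplicialComplex (K A) → IsSimplicialComplex (K (BdIter k A))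
BdIter-isComplex zero    c = c
BdIter-isComplex (suc k) {A} c = Bd-closed (K (BdIter k A)) (BdIter-isComplex k c)

SdIter-Span : ∀ k {A} → IsSimplicialComplex (K A) →
  ∀ {x} → Span (IsSimplex (K A)) x → Span (IsSimplex (K (BdIter k A))) (SdIter k {A} x)
SdIter-Span zero    c s = s
SdIter-Span (suc k) {A} c s =
  Sd-Span (K (BdIter k A)) (BdIter-isComplex k c) (SdIter-Span k c s)

-- Enumeration of the simplices

subsets : ∀ n → List (Subset n)
subsets zero    = [] ∷ []
subsets (suc n) = map (false ∷_) (subsets n) ++ map (true ∷_) (subsets n)

∈-subsets : ∀ {n} (σ : Subset n) → σ ∈ₗ subsets n
∈-subsets []          = here refl
∈-subsets {suc n} (false ∷ σ) = ∈-++⁺ˡ (∈-map⁺ (false ∷_) (∈-subsets σ))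
∈-subsets {suc n} (true ∷ σ)  =
  ∈-++⁺ʳ (map (false ∷_) (subsets n)) (∈-map⁺ (true ∷_) (∈-subsets σ))

subsets-unique : ∀ n → Unique (subsets n)
subsets-unique zero    = [] ∷ []
subsets-unique (suc n) = Unique.++⁺
  (Unique.map⁺ (λ { refl → refl }) (subsets-unique n))
  (Unique.map⁺ (λ { refl → refl }) (subsets-unique n))
  disjoint
  where
    disjoint : ∀ {σ} → ¬ (σ ∈ₗ map (false ∷_) (subsets n) × σ ∈ₗ map (true ∷_) (subsets n))
    disjoint (p , r) with ∈-map⁻ (false ∷_) p | ∈-map⁻ (true ∷_) r
    ... | _ , _ , refl | _ , _ , ()

-- Double negation commutes with finite conjunctions; here the conjunction is halved according to
-- whether the first vertex belongs to the subset.
¬¬-decidable : ∀ {n} (P : Subset n → Set) → ¬ ¬ (∀ σ → Dec (P σ))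
¬¬-decidable {zero} P contra = contra λ { [] → no λ p → contra λ { [] → yes p } }
¬¬-decidable {suc n} P contra =
  ¬¬-decidable (P ∘ (false ∷_)) λ d₀ → ¬¬-decidable (P ∘ (true ∷_)) λ d₁ →
    contra λ { (false ∷ σ) → d₀ σ ; (true ∷ σ) → d₁ σ }

⁅⁆-injective : ∀ {n} {v w : Fin n} → ⁅ v ⁆ ≡ ⁅ w ⁆ → v ≡ w
⁅⁆-injective {v = v} {w} e = x∈⁅y⁆⇒x≡y w (subst (v ∈_) e (x∈⁅x⁆ v))

-- Otherwise p z = -1, and absolute values would make p, which is at least 2, a divisor of 1.
1+multiple≢0 : ∀ q z → 1ℤ + pos (suc (suc q)) * z ≢ 0ℤ
1+multiple≢0 q z e = p≢1 (ℕ.m*n≡1⇒m≡1 p ∣ z ∣ᶻ (begin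
  p ℕ.* ∣ z ∣ᶻ    ≡⟨ sym (ℤ.abs-* (pos p) z) ⟩
  ∣ pos p * z ∣ᶻ  ≡⟨ cong ∣_∣ᶻ minus-one ⟩
  1               ∎))
  where
    p = suc (suc q)
    p≢1 : p ≢ 1
    p≢1 ()
    minus-one : pos p * z ≡ -1ℤ
    minus-one = begin
      pos p * z               ≡⟨ sym (ℤ.+-identityˡ (pos p * z)) ⟩
      -1ℤ + 1ℤ + pos p * z    ≡⟨ ℤ.+-assoc -1ℤ 1ℤ (pos p * z) ⟩
      -1ℤ + (1ℤ + pos p * z)  ≡⟨ cong (-1ℤ +_) e ⟩
      -1ℤ                     ∎

-- The trace of the chain map of a cone extension

module _ {q : ℕ} {A : CxAct} (F : FreeComplex (suc (suc q)) A) (k : ℕ)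
  (f : Fin (suc (n (K (BdIter k A)))) → Fin (n (K A)))
  (simplicial : IsSimplicialMap (Cone (K (BdIter k A))) (K A) f)
  (equivariant : IsEquivariant (suc (suc q)) (BdIter k A) A (f ∘ coneIncl)) where

  open FreeComplex F

  private
    p : ℕ
    p = suc (suc q)
    T : Subset (n (K A)) → Set
    T = IsSimplex (K A)
    B : CxAct
    B = BdIter k A
    f′ : Fin (n (K B)) → Fin (n (K A))
    f′ = f ∘ suc
    g : Fin (n (K A)) → Fin (n (K A))
    g = act A 1

    φ h ψ : Λ (n (K A)) → Λ (n (K A))
    φ x = push f′ (SdIter k x)
    h x = f zero ∧ φ x
    ψ x = φ (ε x)

    φ-linear : Linear φ
    φ-linear = ∘-linear (push-linear f′) (SdIter-linear k)

    h-linear : Linear h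
    h-linear = ∘-linear (∧-linear (f zero)) φ-linear

    ψ-linear : Linear ψ
    ψ-linear = ∘-linear φ-linear ε-linear

    -- Since `φ` commutes with ∂, the term h(∂x) is `f zero` ∧ ∂(φx). What remains is the
    -- contraction identity for the image of the apex, applied to φx.
    nullhomotopic : ∀ x → φ x ≡ ∂ (h x) ⊕ h (∂ x)
    nullhomotopic x = sym (trans
      (cong (λ z → ∂ (h x) ⊕ f zero ∧ z) (trans (cong (push f′) (sym (∂-SdIter k x))) (sym (∂-push f′ (SdIter k x)))))
      (∂-∧ (f zero) (φ x)))

    h-Span : ∀ {x} → Span T x → Span T (h x)
    h-Span s = Span-map (∘-linear (∧-linear (f zero)) (push-linear f′)) cone
      (SdIter-Span k isComplex s)
      where
        cone : ∀ {σ} → IsSimplex (K B) σ → Span T (f zero ∧ push f′ (basis σ))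
        cone {σ} s = subst (Span T)
          (trans (cong (_⊕ f zero ∧ push f′ (basis σ)) (𝟎-homo (push-linear f′))) (⊕-identityˡ _))
          -- `true ∷ σ` is the simplex spanned by the apex and `σ`. The defining formula of `push f`
          -- on it is the coned chain up to a zero term, so simpliciality of `f` on the cone keeps
          -- `h` inside the complex.
          (push-basis-Span f {true ∷ σ} (simplicial (true ∷ σ) (tt , s)))

    -- Equivariance is given for images of simplices; singletons turn it into a statement about
    -- vertices, and `σ` certifies that `v` is not a ghost.
    vertex-equivariant : ∀ {σ v} → IsSimplex (K B) σ → v ∈ σ → f′ (act B 1 v) ≡ g (f′ v)
    vertex-equivariant {σ} {v} s v∈σ = ⁅⁆-injective (begin
      ⁅ f′ (act B 1 v) ⁆           ≡⟨ sym (img-⁅⁆ f′ (act B 1 v)) ⟩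
      img f′ ⁅ act B 1 v ⁆         ≡⟨ cong (img f′) (sym (img-⁅⁆ (act B 1) v)) ⟩
      img f′ (img (act B 1) ⁅ v ⁆) ≡⟨ equivariant 1 (s≤s (s≤s z≤n)) ⁅ v ⁆
        (proj₂ (BdIter-isComplex k isComplex) ⁅v⁆⊆σ s) ⟩
      img g (img f′ ⁅ v ⁆)         ≡⟨ cong (img g) (img-⁅⁆ f′ v) ⟩
      img g ⁅ f′ v ⁆               ≡⟨ img-⁅⁆ g (f′ v) ⟩
      ⁅ g (f′ v) ⁆                 ∎)
      where
        ⁅v⁆⊆σ : ⁅ v ⁆ ⊆ σ
        ⁅v⁆⊆σ r rewrite x∈⁅y⁆⇒x≡y v r = v∈σ

    -- Subdivision commutes with the action on all chains, but `f′` only on chains of the subdivided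
    -- complex; hence the spanning hypothesis.
    φ-equivariant : ∀ {x} → Span T x → φ (push g x) ≡ push g (φ x)
    φ-equivariant {x} s = begin
      push f′ (SdIter k (push g x))
        ≡⟨ cong (push f′) (sym (push-SdIter k 1 x)) ⟩
      push f′ (push (act B 1) (SdIter k x))
        ≡⟨ agree-on-Span (∘-linear (push-linear f′) (push-linear (act B 1)))
             (∘-linear (push-linear g) (push-linear f′)) on-simplex (SdIter-Span k isComplex s) ⟩
      push g (push f′ (SdIter k x)) ∎
      where
        on-simplex : ∀ {σ} → IsSimplex (K B) σ →
          push f′ (push (act B 1) (basis σ)) ≡ push g (push f′ (basis σ))
        on-simplex {σ} s = begin
          push f′ (push (act B 1) (basis σ)) ≡⟨ push-∘ f′ (act B 1) (basis σ) ⟩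
          push (f′ ∘ act B 1) (basis σ)      ≡⟨ push-cong σ (vertex-equivariant s) ⟩
          push (g ∘ f′) (basis σ)            ≡⟨ sym (push-∘ g f′ (basis σ)) ⟩
          push g (push f′ (basis σ))         ∎

    ψ-equivariant : ∀ {x} → Span T x → ψ (push g x) ≡ push g (ψ x)
    ψ-equivariant {x} s = trans (cong φ (ε-push g x)) (φ-equivariant (ε-Span s))

    ψ-∅ : ψ (basis ∅) ≡ basis ∅
    ψ-∅ = begin
      push f′ (SdIter k (ε (basis ∅)))  ≡⟨ cong (push f′ ∘ SdIter k) ε-∅ ⟩
      push f′ (SdIter k (basis ∅))      ≡⟨ cong (push f′) (SdIter-∅ k) ⟩
      push f′ (basis ∅)                 ≡⟨ push-∅ f′ ⟩
      basis ∅                           ∎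

    act-0 : ∀ σ → img (act A 0) σ ≡ σ
    act-0 = img-id (proj₁ isAction)

    act-+ : ∀ a b σ → img (act A (a ℕ.+ b)) σ ≡ img (act A a) (img (act A b) σ)
    act-+ a b σ = trans (img-cong (proj₁ (proj₂ isAction) a b) σ) (sym (img-∘ (act A a) (act A b) σ))

    act-p : ∀ σ → img (act A p) σ ≡ σ
    act-p = img-id (proj₁ (proj₂ (proj₂ isAction)))

    act-inverseᵛ : ∀ v → act A (suc q) (g v) ≡ v
    act-inverseᵛ v = trans (sym (proj₁ (proj₂ isAction) (suc q) 1 v))
      (trans (cong (λ m → act A m v) (ℕ.+-comm (suc q) 1)) (proj₁ (proj₂ (proj₂ isAction)) v))

  not-decidable : ¬ (∀ σ → Dec (T σ))
  not-decidable T? = 1+multiple≢0 q (proj₁ ∑-L′) (begin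
    -- `L` is listed with ∅ first, so its trace unfolds to the diagonal entry at ∅ plus the sum over
    -- the nonempty simplices.
    1ℤ + pos p * proj₁ ∑-L′  ≡⟨ cong₂ _+_ (sym ∅-contribution) (sym (proj₂ ∑-L′)) ⟩
    trace L ψ               ≡⟨ supertrace-nullhomotopic L-unique L-closed {φ} {h} h-linear
                                 (λ s → Span-mono T⇒L (h-Span (Span-mono L⇒T s))) nullhomotopic ⟩
    0ℤ                      ∎)
    where
      T⁺? : ∀ σ → Dec (T σ × Nonempty σ)
      T⁺? σ = T? σ ×-dec nonempty? σ

      L′ L : List (Subset (n (K A)))
      L′ = filter T⁺? (subsets (n (K A)))
      L  = ∅ ∷ L′

      L′⇒T⁺ : ∀ {σ} → σ ∈ₗ L′ → T σ × Nonempty σ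
      L′⇒T⁺ r = proj₂ (∈-filter⁻ T⁺? {xs = subsets (n (K A))} r)

      T⁺⇒L′ : ∀ {σ} → T σ × Nonempty σ → σ ∈ₗ L′
      T⁺⇒L′ {σ} = ∈-filter⁺ T⁺? (∈-subsets σ)

      L⇒T : ∀ {σ} → σ ∈ₗ L → T σ
      L⇒T (here refl) = proj₁ isComplex
      L⇒T (there r)   = proj₁ (L′⇒T⁺ r)

      T⇒L : ∀ {σ} → T σ → σ ∈ₗ L
      T⇒L {σ} s with ∅-or-nonempty σ
      ... | inj₁ refl = here refl
      ... | inj₂ ne   = there (T⁺⇒L′ (s , ne))

      L-unique : Unique L
      L-unique = All.tabulate (λ { r refl → ∉⊥ (proj₂ (proj₂ (L′⇒T⁺ r))) }) ∷
        Unique.filter⁺ T⁺? (subsets-unique (n (K A)))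

      L-closed : ∀ {σ τ} → τ ⊆ σ → σ ∈ₗ L → τ ∈ₗ L
      L-closed τ⊆σ r = T⇒L (proj₂ isComplex τ⊆σ (L⇒T r))

      diagonal : Subset (n (K A)) → ℤ
      diagonal σ = coeff (ψ (basis σ)) σ

      ∅-contribution : diagonal ∅ ≡ 1ℤ
      ∅-contribution = trans (cong (λ z → coeff z ∅) ψ-∅) (coeff-basis-≡ (∅ {n (K A)}))

      ∑-L′ : ∃ λ c → ∑ L′ diagonal ≡ pos p * c
      ∑-L′ = ∑-multiple (≡-dec _≟ᵇ_) (suc q) (λ a → img (act A a)) act-0 act-+ act-p L′
        (Unique.filter⁺ T⁺? (subsets-unique (n (K A))))
        (λ r → let s , ne = L′⇒T⁺ r in
          T⁺⇒L′ (proj₂ (proj₂ (proj₂ isAction)) 1 _ s , img-nonempty g ne))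
        (λ r a 0<a a<p → let s , ne = L′⇒T⁺ r in isFree a 0<a a<p _ s ne)
        diagonal
        -- The inverse of the generator is its power p - 1, that is `suc q`.
        (λ {σ} r → diagonal-invariant {g = g} {act A (suc q)} act-inverseᵛ ψ-linear σ
          (ψ-equivariant (s-basis (proj₁ (L′⇒T⁺ r)))))

  no-equivariant-cone-extension : ⊥
  no-equivariant-cone-extension = ¬¬-decidable T not-decidable

theorem1p8 : (p : ℕ) → Prime p → (k m : ℕ) → 1 ≤ m → (S : Fin m → ZpSphere p) →
    ¬ (Σ (Fin (suc (n (K (BdIter k (joinAll m S))))) → Fin (n (K (joinAll m S)))) λ f →
    IsSimplicialMap (Cone (K (BdIter k (joinAll m S)))) (K (joinAll m S)) f ×
    IsEquivariant p (BdIter k (joinAll m S)) (joinAll m S) (f ∘ coneIncl))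
theorem1p8 p p-prime k (suc m) _ S (f , simplicial , equivariant)
  with p | ℕ.nonTrivial⇒n>1 p {{prime⇒nonTrivial p-prime}}
... | suc (suc q) | s≤s (s≤s z≤n) =
  no-equivariant-cone-extension (joinAll-free m S) k f simplicial equivariant
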